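{- Let $n\ge 1$ and let $A_n$ be the $n$-th Adomian polynomial for the nonlinear term $N(u)$. Then $$A_n(u_0,u_1,\ldots,u_n)=\frac{1}{n!}\sum_{k=1}^{n}B_{n,k}\big(1!u_1,2!u_2,\ldots,(n-k+1)!u_{n-k+1}\big)\,N^{(k)}(u_0).$$
   Context: $N$ is a function of one variable, analytic near $u_0$, and $N^{(k)}$ denotes its $k$-th derivative. With $u_\lambda=\sum_{k=0}^{\infty}u_k\lambda^k$ (the series being assumed convergent and $N(u_\lambda)$ analytic in $\lambda$), the $n$-th Adomian polynomial of $N$ is $$A_n(u_0,\ldots,u_n)=\frac{1}{n!}\frac{\partial^n N(u_\lambda)}{\partial\lambda^n}\Big|_{\lambda=0},$$ equivalently $$A_n(u_0,\ldots,u_n)=\frac{1}{n!}\frac{\partial^n}{\partial\lambda^n}N\Big(\sum_{k=0}^{n}u_k\lambda^k\Big)\Big|_{\lambda=0}.$$ For $1\le k\le n$, the partial exponential Bell polynomial is $$B_{n,k}(x_1,\ldots,x_{n-k+1})=n!\sum_{\Lambda^k_n}\prod_{j=1}^{n-k+1}\frac{1}{k_j!}\Big(\frac{x_j}{j!}\Big)^{k_j},$$ where the sum is over $\Lambda^k_n=\{(k_1,\ldots,k_{n-k+1}): \sum_j k_j=k,\ \sum_j jk_j=n,\ k_j\in\mathbb{Z}_{\ge 0}\}$. -}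

module Defs where

open import Algebra.Bundles.Raw using (RawSemiring)
import Algebra.Definitions.RawSemiring as RawSemiringDefs
open import Data.Fin.Base using (Fin; zero; suc; toℕ)
open import Data.Integer.Base as ℤ using ()
open import Data.List.Base as List using (List; []; _∷_; upTo; filter; cartesianProductWith)
open import Data.Nat.Base as ℕ using (ℕ; zero; suc; _∸_; _!)
import Data.Nat.Properties as ℕ
open import Data.Product.Base using (Σ; ∃; _×_; _,_; proj₁; proj₂)
open import Data.Rational.Base as ℚ using (ℚ; 0ℚ; 1ℚ; ½)
import Data.Rational.Properties as ℚ
open import Data.Rational.Solver using (module +-*-Solver)
open import Data.Vec.Base as Vec using (Vec; []; _∷_; lookup)
open import Data.Vec.Functional using (Vector)
open import Data.Sum.Base using (inj₁; inj₂)
open import Level using (0ℓ)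
open import Relation.Binary.PropositionalEquality using (_≡_; refl; sym; trans; cong; subst)
open import Relation.Nullary.Decidable using (_×-dec_)

dist : ℚ → ℚ → ℚ
dist p q = ℚ.∣ p ℚ.- q ∣

dist-self : ∀ p → dist p p ≡ 0ℚ
dist-self p = cong ℚ.∣_∣ (ℚ.+-inverseʳ p)

half-pos : ∀ {ε} → 0ℚ ℚ.< ε → 0ℚ ℚ.< ½ ℚ.* ε
half-pos {ε} 0<ε = subst (ℚ._< ½ ℚ.* ε) (ℚ.*-zeroʳ ½) (ℚ.*-monoʳ-<-pos ½ 0<ε)

halves : ∀ ε → ½ ℚ.* ε ℚ.+ ½ ℚ.* ε ≡ ε
halves ε = trans (sym (ℚ.*-distribʳ-+ ε ½ ½)) (ℚ.*-identityˡ ε)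

+-close : ∀ {ε} a a' b b' → dist a a' ℚ.< ½ ℚ.* ε → dist b b' ℚ.< ½ ℚ.* ε →
          dist (a ℚ.+ b) (a' ℚ.+ b') ℚ.< ε
+-close {ε} a a' b b' p q = begin-strict
  ℚ.∣ (a ℚ.+ b) ℚ.- (a' ℚ.+ b') ∣             ≡⟨ cong ℚ.∣_∣ rearrange ⟩
  ℚ.∣ (a ℚ.- a') ℚ.+ (b ℚ.- b') ∣             ≤⟨ ℚ.∣p+q∣≤∣p∣+∣q∣ (a ℚ.- a') (b ℚ.- b') ⟩
  ℚ.∣ a ℚ.- a' ∣ ℚ.+ ℚ.∣ b ℚ.- b' ∣           <⟨ ℚ.+-mono-< p q ⟩
  ½ ℚ.* ε ℚ.+ ½ ℚ.* ε                         ≡⟨ halves ε ⟩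
  ε                                           ∎
  where
  open ℚ.≤-Reasoning
  open +-*-Solver
  rearrange : (a ℚ.+ b) ℚ.- (a' ℚ.+ b') ≡ (a ℚ.- a') ℚ.+ (b ℚ.- b')
  rearrange = solve 4 (λ a a' b b' → (a :+ b) :- (a' :+ b') := (a :- a') :+ (b :- b')) refl a a' b b'

neg-close : ∀ a a' → dist (ℚ.- a) (ℚ.- a') ≡ dist a a'
neg-close a a' = trans (cong ℚ.∣_∣ (sym (ℚ.neg-distrib-+ a (ℚ.- a')))) (ℚ.∣-p∣≡∣p∣ (a ℚ.- a'))

abs-bound : ∀ a a' → ℚ.∣ a ∣ ℚ.≤ ℚ.∣ a' ∣ ℚ.+ dist a a'
abs-bound a a' = begin
  ℚ.∣ a ∣                        ≡⟨ cong ℚ.∣_∣ (solve 2 (λ a a' → a := a' :+ (a :- a')) refl a a') ⟩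
  ℚ.∣ a' ℚ.+ (a ℚ.- a') ∣        ≤⟨ ℚ.∣p+q∣≤∣p∣+∣q∣ a' (a ℚ.- a') ⟩
  ℚ.∣ a' ∣ ℚ.+ dist a a'         ∎
  where
  open ℚ.≤-Reasoning
  open +-*-Solver

dist-sym : ∀ a a' → dist a a' ≡ dist a' a
dist-sym a a' = trans (cong ℚ.∣_∣ (solve 2 (λ a a' → a :- a' := :- (a' :- a)) refl a a'))
                      (ℚ.∣-p∣≡∣p∣ (a' ℚ.- a))
  where open +-*-Solver

sub-mono : ∀ x y z → x ℚ.≤ y ℚ.+ z → x ℚ.- y ℚ.≤ z
sub-mono x y z p = begin
  x ℚ.- y              ≤⟨ ℚ.+-monoˡ-≤ (ℚ.- y) p ⟩
  (y ℚ.+ z) ℚ.- y      ≡⟨ solve 2 (λ y z → (y :+ z) :- y := z) refl y z ⟩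
  z                    ∎
  where
  open ℚ.≤-Reasoning
  open +-*-Solver

abs-close : ∀ a a' → dist ℚ.∣ a ∣ ℚ.∣ a' ∣ ℚ.≤ dist a a'
abs-close a a' with ℚ.∣p∣≡p∨∣p∣≡-p (ℚ.∣ a ∣ ℚ.- ℚ.∣ a' ∣)
... | inj₁ e = subst (ℚ._≤ dist a a') (sym e) (sub-mono _ _ _ (abs-bound a a'))
... | inj₂ e = begin
  dist ℚ.∣ a ∣ ℚ.∣ a' ∣            ≡⟨ e ⟩
  ℚ.- (ℚ.∣ a ∣ ℚ.- ℚ.∣ a' ∣)       ≡⟨ solve 2 (λ x y → :- (x :- y) := y :- x) refl ℚ.∣ a ∣ ℚ.∣ a' ∣ ⟩
  ℚ.∣ a' ∣ ℚ.- ℚ.∣ a ∣             ≤⟨ sub-mono _ _ _ (abs-bound a' a) ⟩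
  dist a' a                        ≡⟨ dist-sym a' a ⟩
  dist a a'                        ∎
  where
  open ℚ.≤-Reasoning
  open +-*-Solver

shrink : ∀ {B ε} → 0ℚ ℚ.≤ B → 0ℚ ℚ.< ε → ∃ λ δ → 0ℚ ℚ.< δ × B ℚ.* δ ℚ.< ½ ℚ.* ε
shrink {B} {ε} 0≤B 0<ε = δ , 0<δ , (begin-strict
  B ℚ.* δ                ≡⟨ ℚ.+-identityˡ (B ℚ.* δ) ⟨
  0ℚ ℚ.+ B ℚ.* δ         <⟨ ℚ.+-monoˡ-< (B ℚ.* δ) 0<δ ⟩
  δ ℚ.+ B ℚ.* δ          ≡⟨ solve 3 (λ b e i → e :* i :+ b :* (e :* i) := e :* ((con 1ℚ :+ b) :* i)) refl
                              B (½ ℚ.* ε) (ℚ.1/ C) ⟩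
  (½ ℚ.* ε) ℚ.* (C ℚ.* ℚ.1/ C)  ≡⟨ cong ((½ ℚ.* ε) ℚ.*_) (ℚ.*-inverseʳ C) ⟩
  (½ ℚ.* ε) ℚ.* 1ℚ       ≡⟨ ℚ.*-identityʳ (½ ℚ.* ε) ⟩
  ½ ℚ.* ε                ∎)
  where
  open ℚ.≤-Reasoning
  open +-*-Solver
  C = 1ℚ ℚ.+ B
  instance
    C-pos : ℚ.Positive C
    C-pos = ℚ.pos+nonNeg⇒pos 1ℚ B {{ℚ.nonNegative 0≤B}}
    C-nonZero : ℚ.NonZero C
    C-nonZero = ℚ.pos⇒nonZero C
    1/C-pos : ℚ.Positive (ℚ.1/ C)
    1/C-pos = ℚ.1/pos⇒pos C
    ½ε-pos : ℚ.Positive (½ ℚ.* ε)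
    ½ε-pos = ℚ.positive (half-pos 0<ε)
  δ = (½ ℚ.* ε) ℚ.* ℚ.1/ C
  0<δ : 0ℚ ℚ.< δ
  0<δ = ℚ.positive⁻¹ δ {{ℚ.pos*pos⇒pos (½ ℚ.* ε) (ℚ.1/ C)}}

*-bound : ∀ {B δ} c d → ℚ.∣ c ∣ ℚ.≤ B → ℚ.∣ d ∣ ℚ.< δ → ℚ.∣ c ℚ.* d ∣ ℚ.≤ B ℚ.* δ
*-bound {B} {δ} c d c≤B d<δ = begin
  ℚ.∣ c ℚ.* d ∣            ≡⟨ ℚ.∣p*q∣≡∣p∣*∣q∣ c d ⟩
  ℚ.∣ c ∣ ℚ.* ℚ.∣ d ∣      ≤⟨ ℚ.*-monoʳ-≤-nonNeg ℚ.∣ d ∣ {{ℚ.nonNegative (ℚ.0≤∣p∣ d)}} c≤B ⟩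
  B ℚ.* ℚ.∣ d ∣            ≤⟨ ℚ.*-monoˡ-≤-nonNeg B {{ℚ.nonNegative (ℚ.≤-trans (ℚ.0≤∣p∣ c) c≤B)}} (ℚ.<⇒≤ d<δ) ⟩
  B ℚ.* δ                  ∎
  where open ℚ.≤-Reasoning

*-close : ∀ {A B ε δ δ'} a a' b b' → ℚ.∣ a ∣ ℚ.≤ A → ℚ.∣ b' ∣ ℚ.≤ B →
          A ℚ.* δ ℚ.< ½ ℚ.* ε → B ℚ.* δ' ℚ.< ½ ℚ.* ε →
          dist b b' ℚ.< δ → dist a a' ℚ.< δ' → dist (a ℚ.* b) (a' ℚ.* b') ℚ.< ε
*-close {A} {B} {ε} {δ} {δ'} a a' b b' a≤A b≤B p q r s = begin-strict
  ℚ.∣ a ℚ.* b ℚ.- a' ℚ.* b' ∣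
    ≡⟨ cong ℚ.∣_∣ (solve 4 (λ a a' b b' → a :* b :- a' :* b' := a :* (b :- b') :+ b' :* (a :- a')) refl a a' b b') ⟩
  ℚ.∣ a ℚ.* (b ℚ.- b') ℚ.+ b' ℚ.* (a ℚ.- a') ∣
    ≤⟨ ℚ.∣p+q∣≤∣p∣+∣q∣ (a ℚ.* (b ℚ.- b')) (b' ℚ.* (a ℚ.- a')) ⟩
  ℚ.∣ a ℚ.* (b ℚ.- b') ∣ ℚ.+ ℚ.∣ b' ℚ.* (a ℚ.- a') ∣
    ≤⟨ ℚ.+-mono-≤ (*-bound a (b ℚ.- b') a≤A r) (*-bound b' (a ℚ.- a') b≤B s) ⟩
  A ℚ.* δ ℚ.+ B ℚ.* δ'
    <⟨ ℚ.+-mono-< p q ⟩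
  ½ ℚ.* ε ℚ.+ ½ ℚ.* ε
    ≡⟨ halves ε ⟩
  ε ∎
  where
  open ℚ.≤-Reasoning
  open +-*-Solver

-- A real number is a Cauchy sequence of rationals; equality of reals is _≃_,
-- not _≡_.
record ℝ : Set where
  constructor mkℝ
  field
    seq    : ℕ → ℚ
    cauchy : ∀ ε → 0ℚ ℚ.< ε → ∃ λ M → ∀ m n → M ℕ.≤ m → M ℕ.≤ n → dist (seq m) (seq n) ℚ.< ε

open ℝ public

infix 4 _≃_ _<_ _≤_

_≃_ : ℝ → ℝ → Set
x ≃ y = ∀ ε → 0ℚ ℚ.< ε → ∃ λ M → ∀ n → M ℕ.≤ n → dist (seq x n) (seq y n) ℚ.< ε

_<_ : ℝ → ℝ → Set
x < y = ∃ λ ε → 0ℚ ℚ.< ε × ∃ λ M → ∀ n → M ℕ.≤ n → seq x n ℚ.+ ε ℚ.< seq y n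

_≤_ : ℝ → ℝ → Set
x ≤ y = ∀ ε → 0ℚ ℚ.< ε → ∃ λ M → ∀ n → M ℕ.≤ n → seq x n ℚ.< seq y n ℚ.+ ε

bounded : ∀ x → ∃ λ B → 0ℚ ℚ.≤ B × ∃ λ M → ∀ n → M ℕ.≤ n → ℚ.∣ seq x n ∣ ℚ.≤ B
bounded x with cauchy x 1ℚ (ℚ.positive⁻¹ 1ℚ)
... | M , close = B , ℚ.≤-trans (ℚ.0≤∣p∣ (seq x M)) (bound M ℕ.≤-refl) , M , bound
  where
  B = ℚ.∣ seq x M ∣ ℚ.+ 1ℚ
  bound : ∀ n → M ℕ.≤ n → ℚ.∣ seq x n ∣ ℚ.≤ B
  bound n M≤n = ℚ.≤-trans (abs-bound (seq x n) (seq x M))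
                  (ℚ.+-monoʳ-≤ ℚ.∣ seq x M ∣ (ℚ.<⇒≤ (close n M M≤n ℕ.≤-refl)))

fromℚ : ℚ → ℝ
fromℚ q = mkℝ (λ _ → q) λ ε 0<ε → 0 , λ _ _ _ _ → subst (ℚ._< ε) (sym (dist-self q)) 0<ε

infixl 6 _+_ _-_
infixl 7 _*_
infix  8 -_

_+_ : ℝ → ℝ → ℝ
x + y = mkℝ (λ n → seq x n ℚ.+ seq y n) λ ε 0<ε →
  let (M , p) = cauchy x (½ ℚ.* ε) (half-pos 0<ε)
      (K , q) = cauchy y (½ ℚ.* ε) (half-pos 0<ε)
  in M ℕ.⊔ K , λ m n m≥ n≥ →
     +-close (seq x m) (seq x n) (seq y m) (seq y n)
       (p m n (ℕ.m⊔n≤o⇒m≤o M K m≥) (ℕ.m⊔n≤o⇒m≤o M K n≥))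
       (q m n (ℕ.m⊔n≤o⇒n≤o M K m≥) (ℕ.m⊔n≤o⇒n≤o M K n≥))

-_ : ℝ → ℝ
- x = mkℝ (λ n → ℚ.- seq x n) λ ε 0<ε →
  let (M , p) = cauchy x ε 0<ε
  in M , λ m n m≥ n≥ → subst (ℚ._< ε) (sym (neg-close (seq x m) (seq x n))) (p m n m≥ n≥)

_-_ : ℝ → ℝ → ℝ
x - y = x + - y

_*_ : ℝ → ℝ → ℝ
x * y = mkℝ (λ n → seq x n ℚ.* seq y n) λ ε 0<ε →
  let (A , 0≤A , J , a) = bounded x
      (B , 0≤B , K , b) = bounded y
      (δ  , 0<δ  , p)   = shrink 0≤A 0<ε
      (δ' , 0<δ' , q)   = shrink 0≤B 0<ε
      (L , r)           = cauchy y δ 0<δ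
      (M , s)           = cauchy x δ' 0<δ'
  in (J ℕ.⊔ K) ℕ.⊔ (L ℕ.⊔ M) , λ m n m≥ n≥ →
     *-close (seq x m) (seq x n) (seq y m) (seq y n)
       (a m (ℕ.m⊔n≤o⇒m≤o J K (ℕ.m⊔n≤o⇒m≤o (J ℕ.⊔ K) (L ℕ.⊔ M) m≥)))
       (b n (ℕ.m⊔n≤o⇒n≤o J K (ℕ.m⊔n≤o⇒m≤o (J ℕ.⊔ K) (L ℕ.⊔ M) n≥)))
       p q
       (r m n (ℕ.m⊔n≤o⇒m≤o L M (ℕ.m⊔n≤o⇒n≤o (J ℕ.⊔ K) (L ℕ.⊔ M) m≥))
              (ℕ.m⊔n≤o⇒m≤o L M (ℕ.m⊔n≤o⇒n≤o (J ℕ.⊔ K) (L ℕ.⊔ M) n≥)))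
       (s m n (ℕ.m⊔n≤o⇒n≤o L M (ℕ.m⊔n≤o⇒n≤o (J ℕ.⊔ K) (L ℕ.⊔ M) m≥))
              (ℕ.m⊔n≤o⇒n≤o L M (ℕ.m⊔n≤o⇒n≤o (J ℕ.⊔ K) (L ℕ.⊔ M) n≥)))

∣_∣ : ℝ → ℝ
∣ x ∣ = mkℝ (λ n → ℚ.∣ seq x n ∣) λ ε 0<ε →
  let (M , p) = cauchy x ε 0<ε
  in M , λ m n m≥ n≥ → ℚ.≤-<-trans (abs-close (seq x m) (seq x n)) (p m n m≥ n≥)

0ℝ 1ℝ : ℝ
0ℝ = fromℚ 0ℚ
1ℝ = fromℚ 1ℚ

ℝ-rawSemiring : RawSemiring 0ℓ 0ℓ
ℝ-rawSemiring = record
  { Carrier = ℝ ; _≈_ = _≃_ ; _+_ = _+_ ; _*_ = _*_ ; 0# = 0ℝ ; 1# = 1ℝ }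

open RawSemiringDefs ℝ-rawSemiring public using (sum; product; _^_)

≃-refl : ∀ {x} → x ≃ x
≃-refl {x} ε 0<ε = 0 , λ n _ → subst (ℚ._< ε) (sym (dist-self (seq x n))) 0<ε

+-cong : ∀ {x x' y y'} → x ≃ x' → y ≃ y' → x + y ≃ x' + y'
+-cong {x} {x'} {y} {y'} x≃ y≃ ε 0<ε =
  let (M , p) = x≃ (½ ℚ.* ε) (half-pos 0<ε)
      (K , q) = y≃ (½ ℚ.* ε) (half-pos 0<ε)
  in M ℕ.⊔ K , λ n n≥ →
     +-close (seq x n) (seq x' n) (seq y n) (seq y' n)
       (p n (ℕ.m⊔n≤o⇒m≤o M K n≥)) (q n (ℕ.m⊔n≤o⇒n≤o M K n≥))

*-cong : ∀ {x x' y y'} → x ≃ x' → y ≃ y' → x * y ≃ x' * y'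
*-cong {x} {x'} {y} {y'} x≃ y≃ ε 0<ε =
  let (A , 0≤A , J , a) = bounded x
      (B , 0≤B , K , b) = bounded y'
      (δ  , 0<δ  , p)   = shrink 0≤A 0<ε
      (δ' , 0<δ' , q)   = shrink 0≤B 0<ε
      (L , r)           = y≃ δ 0<δ
      (M , s)           = x≃ δ' 0<δ'
  in (J ℕ.⊔ K) ℕ.⊔ (L ℕ.⊔ M) , λ n n≥ →
     *-close (seq x n) (seq x' n) (seq y n) (seq y' n)
       (a n (ℕ.m⊔n≤o⇒m≤o J K (ℕ.m⊔n≤o⇒m≤o (J ℕ.⊔ K) (L ℕ.⊔ M) n≥)))
       (b n (ℕ.m⊔n≤o⇒n≤o J K (ℕ.m⊔n≤o⇒m≤o (J ℕ.⊔ K) (L ℕ.⊔ M) n≥)))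
       p q
       (r n (ℕ.m⊔n≤o⇒m≤o L M (ℕ.m⊔n≤o⇒n≤o (J ℕ.⊔ K) (L ℕ.⊔ M) n≥)))
       (s n (ℕ.m⊔n≤o⇒n≤o L M (ℕ.m⊔n≤o⇒n≤o (J ℕ.⊔ K) (L ℕ.⊔ M) n≥)))

^-cong : ∀ {x y} k → x ≃ y → x ^ k ≃ y ^ k
^-cong             zero    x≃y = ≃-refl {1ℝ}
^-cong {x} {y} (suc k) x≃y = *-cong {x} {y} {x ^ k} {y ^ k} x≃y (^-cong {x} {y} k x≃y)

sum-cong : ∀ {n} (f g : Vector ℝ n) → (∀ i → f i ≃ g i) → sum f ≃ sum g
sum-cong {zero}  f g f≃g = ≃-refl {0ℝ}
sum-cong {suc n} f g f≃g =
  +-cong {f zero} {g zero} {sum (λ i → f (suc i))} {sum (λ i → g (suc i))}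
    (f≃g zero) (sum-cong (λ i → f (suc i)) (λ i → g (suc i)) (λ i → f≃g (suc i)))

-- A function defined on the subset Dom of ℝ.  Since values respect ≃,
-- they do not depend on the proof of membership.
record ℝ⇀ℝ : Set₁ where
  field
    Dom      : ℝ → Set
    app      : ∀ x → Dom x → ℝ
    app-cong : ∀ {x y} (p : Dom x) (q : Dom y) → x ≃ y → app x p ≃ app y q

open ℝ⇀ℝ public

-- f(y) = f(x) + d·(y - x) + o(y - x) as y → x.  The difference quotient is
-- multiplied out because y ≃ x is not decidable.
HasDerivativeAt : (f : ℝ⇀ℝ) (x : ℝ) → Dom f x → ℝ → Set
HasDerivativeAt f x p d =
  ∀ ε → 0ℚ ℚ.< ε → ∃ λ δ → 0ℚ ℚ.< δ ×
    (∀ y (q : Dom f y) → ∣ y - x ∣ < fromℚ δ →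
       ∣ (app f y q - app f x p) - d * (y - x) ∣ ≤ fromℚ ε * ∣ y - x ∣)

-- f and f' are both defined on some open interval around a, and f' is the
-- derivative of f there.
IsDerivativeNear : ℝ → ℝ⇀ℝ → ℝ⇀ℝ → Set
IsDerivativeNear a f f' =
  ∃ λ r → 0ℚ ℚ.< r × (∀ x → ∣ x - a ∣ < fromℚ r →
    Σ (Dom f x) λ p → Σ (Dom f' x) λ q → HasDerivativeAt f x p (app f' x q))

-- IteratedDerivative a d f n : the n-th derivative of f at a exists and
-- equals d.
data IteratedDerivative (a d : ℝ) : ℝ⇀ℝ → ℕ → Set₁ where
  zeroth : ∀ {f} (p : Dom f a) → app f a p ≃ d → IteratedDerivative a d f zero
  next   : ∀ {f n} (f' : ℝ⇀ℝ) → IsDerivativeNear a f f' →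
           IteratedDerivative a d f' n → IteratedDerivative a d f (suc n)

Converges : (ℕ → ℝ) → ℝ → Set
Converges s l = ∀ ε → 0ℚ ℚ.< ε → ∃ λ M → ∀ n → M ℕ.≤ n → ∣ s n - l ∣ < fromℚ ε

AnalyticNear : ℝ → ℝ⇀ℝ → Set
AnalyticNear a f =
  ∃ λ (c : ℕ → ℝ) → ∃ λ r → 0ℚ ℚ.< r × (∀ x → ∣ x - a ∣ < fromℚ r →
    Σ (Dom f x) λ p →
      Converges (λ n → sum {n} λ k → c (toℕ k) * (x - a) ^ toℕ k) (app f x p))

1/_! : ℕ → ℝ
1/ n ! = fromℚ ((ℤ.+ 1) ℚ./ (n !))
  where instance _ = n ℕ.!≢0

_!ℝ : ℕ → ℝ
n !ℝ = fromℚ ((ℤ.+ (n !)) ℚ./ 1)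

curve : (ℕ → ℝ) → ℕ → ℝ → ℝ
curve u n t = sum {suc n} λ k → u (toℕ k) * t ^ toℕ k

curve-cong : ∀ u n {s t} → s ≃ t → curve u n s ≃ curve u n t
curve-cong u n {s} {t} s≃t =
  sum-cong {suc n} (λ k → u (toℕ k) * s ^ toℕ k) (λ k → u (toℕ k) * t ^ toℕ k)
    (λ k → *-cong {u (toℕ k)} {u (toℕ k)} {s ^ toℕ k} {t ^ toℕ k}
             (≃-refl {u (toℕ k)}) (^-cong {s} {t} (toℕ k) s≃t))

alongCurve : ℝ⇀ℝ → (ℕ → ℝ) → ℕ → ℝ⇀ℝ
alongCurve N u n = record
  { Dom      = λ t → Dom N (curve u n t)
  ; app      = λ t p → app N (curve u n t) p
  ; app-cong = λ {s} {t} p q s≃t → app-cong N p q (curve-cong u n {s} {t} s≃t)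
  }

-- A_n(u_0, …, u_n) is the n-th derivative of t ↦ N(Σ_{k=0}^n u_k t^k) at
-- t = 0, divided by n!.  Only the terms u_0, …, u_n of u enter.
IsAdomian : ℝ⇀ℝ → (ℕ → ℝ) → ℕ → ℝ → Set₁
IsAdomian N u n A =
  ∃ λ D → IteratedDerivative 0ℝ D (alongCurve N u n) n × A ≃ 1/ n ! * D

tuples : ∀ m → ℕ → List (Vec ℕ m)
tuples zero    b = [] ∷ []
tuples (suc m) b = cartesianProductWith _∷_ (upTo (suc b)) (tuples m b)

-- The j-th entry (counted from 1) carries weight j.
weight : ∀ {m} → Vec ℕ m → ℕ
weight κ = Vec.sum (Vec.tabulate λ i → suc (toℕ i) ℕ.* lookup κ i)

-- Enumerating vectors with entries at most k loses nothing: nonnegative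
-- entries summing to k are at most k.
Λ : (n k : ℕ) → List (Vec ℕ (suc (n ∸ k)))
Λ n k = filter (λ κ → (Vec.sum κ ℕ.≟ k) ×-dec (weight κ ℕ.≟ n)) (tuples (suc (n ∸ k)) k)

-- The position i of x stands for the argument x_{i+1}; for k ≤ n the number
-- of arguments suc (n ∸ k) is n - k + 1.
Bell : (n k : ℕ) → Vector ℝ (suc (n ∸ k)) → ℝ
Bell n k x =
  n !ℝ * List.foldr _+_ 0ℝ
    (List.map (λ κ → product λ i →
                 1/ lookup κ i ! * (x i * 1/ suc (toℕ i) !) ^ lookup κ i)
              (Λ n k))

{-# OPTIONS --safe #-}
-- Write T(f) for the Taylor series of f at a point.  Differentiation acts on series by
-- (D v)ₙ = (n+1) vₙ₊₁, and since D(T(f ∘ g)) = D(T g) ⊛ T(f' ∘ g), the chain and product rules give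
-- by induction on the order
--   T(f ∘ g) = ∑ₖ f⁽ᵏ⁾(g(t₀)) eₖ,  where e₀ = 1, D eₖ₊₁ = D(T g) ⊛ eₖ, and eₖ₊₁ has no constant term.
-- On the other side, let E(n, k) be the sum of ∏ xⱼ^κⱼ / κⱼ! over Λ(n, k).  Multiplying each summand
-- by n = ∑ j κⱼ and lowering κⱼ by one gives n E(n, k) = ∑ j xⱼ E(n − j, k − 1), which is the recursion
-- defining the coefficients of eₖ.  Derivatives near a point are unique, so A_n is determined.
module Submission where

import Algebra.Definitions.RawSemiring
import Algebra.Properties.Monoid.Sum
import Algebra.Properties.Semiring.Mult
import Algebra.Properties.Semiring.Sum
import Algebra.Solver.Ring.NaturalCoefficients.Default
open import Algebra.Bundles using (CommutativeSemiring)
open import Algebra.Structures.Biased using (module IsCommutativeSemiringˡ)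
open import Data.Fin.Base using (Fin; zero; suc; toℕ)
import Data.Fin.Properties as Fin
open import Data.Integer.Base as ℤ using ()
import Data.Integer.Properties as ℤ
open import Data.List.Base as List using (List; []; _∷_; _++_; applyUpTo; upTo; cartesianProductWith; filter)
open import Data.Nat.Base as ℕ using (ℕ; zero; suc; _!; z≤n; s≤s)
import Data.Nat.Properties as ℕ
open import Data.Product.Base using (Σ; ∃; _×_; _,_; proj₁; proj₂)
open import Data.Rational.Base as ℚ using (ℚ; 0ℚ; 1ℚ; ½)
import Data.Rational.Properties as ℚ
open import Data.Rational.Solver using (module +-*-Solver)
import Data.Rational.Unnormalised.Base as ℚᵘ
import Data.Rational.Unnormalised.Properties as ℚᵘ
open import Data.Sum.Base using (inj₁; inj₂)
open import Data.Unit.Base using (⊤; tt)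
open import Data.Vec.Base as Vec using (Vec; []; _∷_; lookup)
open import Data.Vec.Functional using (Vector; tail)
open import Function.Base using (_∘_; id)
open import Level using (Level; 0ℓ)
import Relation.Binary.Reasoning.Setoid
open import Relation.Binary.PropositionalEquality as ≡ using (_≡_)
open import Relation.Binary.Structures using (IsEquivalence)
open import Relation.Nullary using (¬_; Dec; yes; no)
open import Relation.Nullary.Decidable using (_×-dec_)
open import Relation.Nullary.Negation using (contradiction)
open import Relation.Unary using (Pred; Decidable)
open import Defs using (tuples; weight; Λ)

-- Formal power series

-- The series algebra lives over an arbitrary commutative semiring with inverse factorials. Nothing
-- in it subtracts: (w - w 0)^k / k! is obtained by integrating its derivative. The scalars also
-- stay opaque there, whereas comparing two concrete reals would unfold their Cauchy moduli; for the
-- same reason many later lemmas take sequences as variables tied together by `≃`. Neither side is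
-- expanded by the multinomial theorem: both satisfy a recursion for n+1 times the coefficient n+1,
-- and the factor n+1 can be cancelled. On the Bell side the constraints on sum and weight become
-- Kronecker deltas, because lowering one exponent is awkward on a filtered list but a mere shift
-- for a function of weight and sum.

module FormalSeries {c ℓ : Level} (S : CommutativeSemiring c ℓ) where

  open CommutativeSemiring S renaming (zero to *-zero)
  open Algebra.Properties.Semiring.Mult semiring renaming (_×_ to _·_; ×-congʳ to ·-congʳ)
  open Algebra.Properties.Semiring.Sum semiring
  open Algebra.Definitions.RawSemiring rawSemiring using (product; _^_)
  open Algebra.Properties.Monoid.Sum *-monoid using () renaming (sum-cong-≋ to product-cong)
  open Relation.Binary.Reasoning.Setoid setoid
  open Algebra.Solver.Ring.NaturalCoefficients.Default S using (solve; _:+_; _:*_; _:=_)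

  infixl 7 _⊛_

  D : (ℕ → Carrier) → ℕ → Carrier
  D v n = suc n · v (suc n)

  -- The Cauchy product, read off from v = v 0 + t · (v ∘ suc); this recursion needs no difference
  -- of indices.
  _⊛_ : (v w : ℕ → Carrier) → ℕ → Carrier
  (v ⊛ w) zero    = v 0 * w 0
  (v ⊛ w) (suc n) = v 0 * w (suc n) + (v ∘ suc ⊛ w) n

  constant : Carrier → ℕ → Carrier
  constant x zero    = x
  constant x (suc n) = 0#

  ·-comm : ∀ m n x → m · (n · x) ≈ n · (m · x)
  ·-comm m n x = begin
    m · (n · x)     ≈⟨ ×-assocˡ x m n ⟩
    (m ℕ.* n) · x   ≡⟨ ≡.cong (_· x) (ℕ.*-comm m n) ⟩
    (n ℕ.* m) · x   ≈⟨ ×-assocˡ x n m ⟨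
    n · (m · x)     ∎

  ·-distrib-+ : ∀ n x y → n · (x + y) ≈ n · x + n · y
  ·-distrib-+ zero    x y = sym (+-identityˡ 0#)
  ·-distrib-+ (suc n) x y = begin
    (x + y) + n · (x + y)      ≈⟨ +-congˡ (·-distrib-+ n x y) ⟩
    (x + y) + (n · x + n · y)  ≈⟨ solve 4 (λ x y a b → (x :+ y) :+ (a :+ b) := (x :+ a) :+ (y :+ b)) refl x y (n · x) (n · y) ⟩
    (x + n · x) + (y + n · y)  ∎

  ·-zeroʳ : ∀ n → n · 0# ≈ 0#
  ·-zeroʳ zero    = refl
  ·-zeroʳ (suc n) = trans (+-identityˡ _) (·-zeroʳ n)

  ·-distrib-sum : ∀ {m} n (f : Vector Carrier m) → n · sum f ≈ ∑[ i < m ] (n · f i)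
  ·-distrib-sum {zero}  n f = ·-zeroʳ n
  ·-distrib-sum {suc m} n f = trans (·-distrib-+ n _ _) (+-congˡ (·-distrib-sum n (tail f)))

  sum-zero : ∀ {m} (f : Vector Carrier m) → (∀ i → f i ≈ 0#) → sum f ≈ 0#
  sum-zero {m} f f≈0 = trans (sum-cong-≋ f≈0) (sum-replicate-zero m)

  ⊛-cong : ∀ {v v' w w' : ℕ → Carrier} → (∀ n → v n ≈ v' n) → (∀ n → w n ≈ w' n) → ∀ n → (v ⊛ w) n ≈ (v' ⊛ w') n
  ⊛-cong v≈ w≈ zero    = *-cong (v≈ 0) (w≈ 0)
  ⊛-cong v≈ w≈ (suc n) = +-cong (*-cong (v≈ 0) (w≈ (suc n))) (⊛-cong (v≈ ∘ suc) w≈ n)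

  ⊛-distribʳ-+ : ∀ v v' w n → ((λ j → v j + v' j) ⊛ w) n ≈ (v ⊛ w) n + (v' ⊛ w) n
  ⊛-distribʳ-+ v v' w zero    = distribʳ _ _ _
  ⊛-distribʳ-+ v v' w (suc n) = begin
    (v 0 + v' 0) * w (suc n) + ((λ j → v (suc j) + v' (suc j)) ⊛ w) n
      ≈⟨ +-cong (distribʳ _ _ _) (⊛-distribʳ-+ (v ∘ suc) (v' ∘ suc) w n) ⟩
    (v 0 * w (suc n) + v' 0 * w (suc n)) + ((v ∘ suc ⊛ w) n + (v' ∘ suc ⊛ w) n)
      ≈⟨ solve 4 (λ x y a b → (x :+ y) :+ (a :+ b) := (x :+ a) :+ (y :+ b)) refl _ _ _ _ ⟩
    (v 0 * w (suc n) + (v ∘ suc ⊛ w) n) + (v' 0 * w (suc n) + (v' ∘ suc ⊛ w) n) ∎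

  ⊛-linear-sum : ∀ {m} v (r : Vector Carrier m) (w : Fin m → ℕ → Carrier) n →
                 (v ⊛ (λ j → ∑[ i < m ] (r i * w i j))) n ≈ ∑[ i < m ] (r i * (v ⊛ w i) n)
  ⊛-linear-sum v r w zero    = trans (*-distribˡ-sum (v 0) (λ i → r i * w i 0)) (sum-cong-≋ λ i →
    solve 3 (λ x y z → x :* (y :* z) := y :* (x :* z)) refl (v 0) (r i) (w i 0))
  ⊛-linear-sum {m} v r w (suc n) = begin
    v 0 * ∑[ i < m ] (r i * w i (suc n)) + (v ∘ suc ⊛ (λ j → ∑[ i < m ] (r i * w i j))) n
      ≈⟨ +-cong (*-distribˡ-sum (v 0) (λ i → r i * w i (suc n))) (⊛-linear-sum (v ∘ suc) r w n) ⟩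
    ∑[ i < m ] (v 0 * (r i * w i (suc n))) + ∑[ i < m ] (r i * (v ∘ suc ⊛ w i) n)
      ≈⟨ ∑-distrib-+ (λ i → v 0 * (r i * w i (suc n))) (λ i → r i * (v ∘ suc ⊛ w i) n) ⟨
    ∑[ i < m ] (v 0 * (r i * w i (suc n)) + r i * (v ∘ suc ⊛ w i) n)
      ≈⟨ sum-cong-≋ (λ i → solve 4 (λ x y z t → x :* (y :* z) :+ y :* t := y :* (x :* z :+ t)) refl
           (v 0) (r i) (w i (suc n)) ((v ∘ suc ⊛ w i) n)) ⟩
    ∑[ i < m ] (r i * (v ⊛ w i) (suc n)) ∎

  ⊛-zeroʳ : ∀ v w n → (∀ j → j ℕ.≤ n → w j ≈ 0#) → (v ⊛ w) n ≈ 0#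
  ⊛-zeroʳ v w zero    w≈0 = trans (*-congˡ (w≈0 0 z≤n)) (zeroʳ (v 0))
  ⊛-zeroʳ v w (suc n) w≈0 = begin
    v 0 * w (suc n) + (v ∘ suc ⊛ w) n
      ≈⟨ +-cong (*-congˡ (w≈0 (suc n) ℕ.≤-refl)) (⊛-zeroʳ (v ∘ suc) w n λ j j≤n → w≈0 j (ℕ.m≤n⇒m≤1+n j≤n)) ⟩
    v 0 * 0# + 0#   ≈⟨ +-identityʳ _ ⟩
    v 0 * 0#        ≈⟨ zeroʳ (v 0) ⟩
    0#              ∎

  ⊛-zeroˡ : ∀ v w n → (∀ j → v j ≈ 0#) → (v ⊛ w) n ≈ 0#
  ⊛-zeroˡ v w zero    v≈0 = trans (*-congʳ (v≈0 0)) (zeroˡ (w 0))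
  ⊛-zeroˡ v w (suc n) v≈0 = trans
    (+-cong (trans (*-congʳ (v≈0 0)) (zeroˡ _)) (⊛-zeroˡ (v ∘ suc) w n (v≈0 ∘ suc))) (+-identityˡ 0#)

  ⊛-identityˡ : ∀ w n → (constant 1# ⊛ w) n ≈ w n
  ⊛-identityˡ w zero    = *-identityˡ (w 0)
  ⊛-identityˡ w (suc n) =
    trans (+-cong (*-identityˡ _) (⊛-zeroˡ _ w n λ _ → refl)) (+-identityʳ _)

  variable-series : ℕ → Carrier
  variable-series zero    = 0#
  variable-series (suc n) = constant 1# n

  variable-⊛-suc : ∀ w n → (variable-series ⊛ w) (suc n) ≈ w n
  variable-⊛-suc w n = trans (+-cong (zeroˡ _) (⊛-identityˡ w n)) (+-identityˡ _)

  -- Induction along v = v 0 + t · tv. One copy of `tv ⊛ w` is split off the multiple n+2 and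
  -- supplies the first summand of D(t · tv) = tv + t · D tv; the other n+1 copies fall to the
  -- induction hypothesis.
  leibniz : ∀ v w n → D (v ⊛ w) n ≈ (D v ⊛ w) n + (v ⊛ D w) n
  leibniz v w zero = begin
    1 · (v 0 * w 1 + v 1 * w 0)           ≈⟨ ×-homo-1 _ ⟩
    v 0 * w 1 + v 1 * w 0                 ≈⟨ +-comm _ _ ⟩
    v 1 * w 0 + v 0 * w 1                 ≈⟨ +-cong (*-congʳ (×-homo-1 (v 1))) (*-congˡ (×-homo-1 (w 1))) ⟨
    (1 · v 1) * w 0 + v 0 * (1 · w 1)     ∎
  leibniz v w (suc n) = begin
    suc (suc n) · (v 0 * w (suc (suc n)) + (tv ⊛ w) (suc n))
      ≈⟨ ·-distrib-+ (suc (suc n)) _ _ ⟩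
    suc (suc n) · (v 0 * w (suc (suc n))) + ((tv ⊛ w) (suc n) + suc n · (tv ⊛ w) (suc n))
      ≈⟨ +-cong (sym (×-comm-* (suc (suc n)) _ _)) (+-congˡ (leibniz tv w n)) ⟩
    v 0 * D w (suc n) + ((v 1 * w (suc n) + (tv ∘ suc ⊛ w) n) + ((D tv ⊛ w) n + (tv ⊛ D w) n))
      ≈⟨ solve 5 (λ a b c d e → a :+ ((b :+ c) :+ (d :+ e)) := (b :+ (c :+ d)) :+ (a :+ e)) refl _ _ _ _ _ ⟩
    (v 1 * w (suc n) + ((tv ∘ suc ⊛ w) n + (D tv ⊛ w) n)) + (v 0 * D w (suc n) + (tv ⊛ D w) n)
      ≈⟨ +-congʳ (+-cong (*-congʳ (sym (×-homo-1 (v 1)))) (sym (⊛-distribʳ-+ (tv ∘ suc) (D tv) w n))) ⟩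
    (D v 0 * w (suc n) + (D v ∘ suc ⊛ w) n) + (v ⊛ D w) (suc n) ∎
    where tv = v ∘ suc

  D-cong : ∀ {v w : ℕ → Carrier} → (∀ n → v n ≈ w n) → ∀ n → D v n ≈ D w n
  D-cong v≈w n = ·-congʳ (suc n) (v≈w (suc n))

  D-+ : ∀ {v v' w w' x : ℕ → Carrier} → (∀ n → x n ≈ v n + w n) → (∀ n → v' n ≈ D v n) → (∀ n → w' n ≈ D w n) →
        ∀ n → D x n ≈ v' n + w' n
  D-+ {x = x} x≈ v'≈ w'≈ n = trans (D-cong {x} x≈ n)
    (trans (·-distrib-+ (suc n) _ _) (sym (+-cong (v'≈ n) (w'≈ n))))

  D-⊛ : ∀ {v v' w w' x : ℕ → Carrier} → (∀ n → x n ≈ (v ⊛ w) n) → (∀ n → v' n ≈ D v n) → (∀ n → w' n ≈ D w n) →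
        ∀ n → D x n ≈ (v' ⊛ w) n + (v ⊛ w') n
  D-⊛ {v} {v'} {w} {w'} {x} x≈ v'≈ w'≈ n = trans (D-cong {x} {v ⊛ w} x≈ n) (trans (leibniz v w n)
    (sym (+-cong (⊛-cong {v'} {D v} {w} {w} v'≈ (λ _ → refl) n) (⊛-cong {v} {v} {w'} {D w} (λ _ → refl) w'≈ n))))

  D-constant : ∀ {x : ℕ → Carrier} c → (∀ n → x n ≈ constant c n) → ∀ n → D x n ≈ constant 0# n
  D-constant c x≈ zero    = trans (D-cong x≈ 0) (·-zeroʳ 1)
  D-constant c x≈ (suc n) = trans (D-cong x≈ (suc n)) (·-zeroʳ (suc (suc n)))

  D-variable : ∀ {x : ℕ → Carrier} → (∀ n → x n ≈ variable-series n) → ∀ n → D x n ≈ constant 1# n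
  D-variable x≈ zero    = trans (D-cong x≈ 0) (×-homo-1 1#)
  D-variable x≈ (suc n) = trans (D-cong x≈ (suc n)) (·-zeroʳ (suc (suc n)))

  upToDegree : ℕ → (ℕ → Carrier) → ℕ → Carrier
  upToDegree zero    u         = constant (u 0)
  upToDegree (suc n) u zero    = u 0
  upToDegree (suc n) u (suc j) = upToDegree n (u ∘ suc) j

  upToDegree-≡ : ∀ {n j} u → j ℕ.≤ n → upToDegree n u j ≡ u j
  upToDegree-≡ {zero}  u z≤n       = ≡.refl
  upToDegree-≡ {suc n} u z≤n       = ≡.refl
  upToDegree-≡ {suc n} u (s≤s j≤n) = upToDegree-≡ (u ∘ suc) j≤n

  -- Horner's step on coefficients, the counterpart of `curve-suc` for functions.
  upToDegree-suc : ∀ n u j →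
    upToDegree (suc n) u j ≈ constant (u 0) j + (variable-series ⊛ upToDegree n (u ∘ suc)) j
  upToDegree-suc n u zero    = sym (trans (+-congˡ (zeroˡ _)) (+-identityʳ (u 0)))
  upToDegree-suc n u (suc j) = sym (trans (+-identityˡ _) (variable-⊛-suc (upToDegree n (u ∘ suc)) j))

  module Exponential (invFact : ℕ → Carrier) (inverse : ∀ n → (n !) · invFact n ≈ 1#) where

    -- n! / (n+1)!, that is 1/(n+1): the factor by which a coefficient is integrated.
    recip : ℕ → Carrier
    recip n = (n !) · invFact (suc n)

    suc·recip : ∀ n x → suc n · (recip n * x) ≈ x
    suc·recip n x = begin
      suc n · (recip n * x)                  ≈⟨ ×-assoc-* (suc n) (recip n) x ⟨
      (suc n · ((n !) · invFact (suc n))) * x  ≈⟨ *-congʳ (×-assocˡ _ (suc n) (n !)) ⟩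
      ((suc n !) · invFact (suc n)) * x       ≈⟨ *-congʳ (inverse (suc n)) ⟩
      1# * x                                 ≈⟨ *-identityˡ x ⟩
      x                                      ∎

    suc·-cancel : ∀ n {x y} → suc n · x ≈ suc n · y → x ≈ y
    suc·-cancel n {x} {y} eq = begin
      x                      ≈⟨ suc·recip n x ⟨
      suc n · (recip n * x)  ≈⟨ ×-comm-* (suc n) (recip n) x ⟨
      recip n * (suc n · x)  ≈⟨ *-congˡ eq ⟩
      recip n * (suc n · y)  ≈⟨ ×-comm-* (suc n) (recip n) y ⟩
      suc n · (recip n * y)  ≈⟨ suc·recip n y ⟩
      y                      ∎

    !·-cancel : ∀ n {x y} → (n !) · x ≈ (n !) · y → x ≈ y
    !·-cancel n {x} {y} eq = trans (sym (unit x)) (trans (*-congˡ eq) (unit y))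
      where
      unit : ∀ z → invFact n * ((n !) · z) ≈ z
      unit z = begin
        invFact n * ((n !) · z)  ≈⟨ ×-comm-* (n !) _ _ ⟩
        (n !) · (invFact n * z)  ≈⟨ ×-assoc-* (n !) _ _ ⟨
        ((n !) · invFact n) * z  ≈⟨ *-congʳ (inverse n) ⟩
        1# * z                   ≈⟨ *-identityˡ z ⟩
        z                        ∎

    suc·invFact : ∀ n → suc n · invFact (suc n) ≈ invFact n
    suc·invFact n = !·-cancel n (begin
      (n !) · (suc n · invFact (suc n))   ≈⟨ ·-comm (n !) (suc n) _ ⟩
      suc n · ((n !) · invFact (suc n))   ≈⟨ ×-assocˡ _ (suc n) (n !) ⟩
      (suc n !) · invFact (suc n)         ≈⟨ inverse (suc n) ⟩
      1#                                  ≈⟨ inverse n ⟨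
      (n !) · invFact n                   ∎)

    -- The divided power (w − w 0)^k / k!, characterised by its derivative w' · (w − w 0)^(k-1) / (k-1)!.
    dividedPower : (ℕ → Carrier) → ℕ → ℕ → Carrier
    dividedPower w zero    n       = constant 1# n
    dividedPower w (suc k) zero    = 0#
    dividedPower w (suc k) (suc n) = recip n * (D w ⊛ dividedPower w k) n

    D-dividedPower : ∀ w k n → D (dividedPower w (suc k)) n ≈ (D w ⊛ dividedPower w k) n
    D-dividedPower w k n = suc·recip n _

    -- Each integration raises the order of vanishing at the base point by one.
    dividedPower-order : ∀ w k n → n ℕ.< k → dividedPower w k n ≈ 0#
    dividedPower-order w (suc k) zero    _         = refl
    dividedPower-order w (suc k) (suc n) (s≤s n<k) = begin
      recip n * (D w ⊛ dividedPower w k) n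
        ≈⟨ *-congˡ (⊛-zeroʳ (D w) _ n λ j j≤n → dividedPower-order w k j (ℕ.≤-<-trans j≤n n<k)) ⟩
      recip n * 0#   ≈⟨ zeroʳ _ ⟩
      0#             ∎

    -- Taylor coefficients of f ∘ g up to order K, given those of f at g(t₀) and of g at t₀.
    compose : ℕ → (v w : ℕ → Carrier) → ℕ → Carrier
    compose K v w n = ∑[ k < suc K ] (((toℕ k !) · v (toℕ k)) * dividedPower w (toℕ k) n)

    compose-zero : ∀ K v w → compose K v w 0 ≈ v 0
    compose-zero K v w = begin
      (1 · v 0) * 1# + ∑[ k < K ] (((suc (toℕ k) !) · v (suc (toℕ k))) * 0#)
        ≈⟨ +-cong (*-identityʳ _) (sum-zero (λ (k : Fin K) → ((suc (toℕ k) !) · v (suc (toℕ k))) * 0#) λ k → zeroʳ _) ⟩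
      1 · v 0 + 0#    ≈⟨ +-identityʳ _ ⟩
      1 · v 0         ≈⟨ ×-homo-1 (v 0) ⟩
      v 0             ∎

    -- The chain rule for series. Differentiation kills the constant term k = 0 and lowers every
    -- other divided power by one, so the truncation drops from `suc K` to `K`; the factors match
    -- because (k+1)! v (k+1) = k! (D v) k.
    D-compose : ∀ K v w n → D (compose (suc K) v w) n ≈ (D w ⊛ compose K (D v) w) n
    D-compose K v w n = begin
      suc n · ((1 · v 0) * 0# + ∑[ k < suc K ] (r k * dividedPower w (suc (toℕ k)) (suc n)))
        ≈⟨ ·-congʳ (suc n) (trans (+-congʳ (zeroʳ _)) (+-identityˡ _)) ⟩
      suc n · (∑[ k < suc K ] (r k * dividedPower w (suc (toℕ k)) (suc n)))
        ≈⟨ ·-distrib-sum (suc n) (λ k → r k * dividedPower w (suc (toℕ k)) (suc n)) ⟩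
      ∑[ k < suc K ] (suc n · (r k * dividedPower w (suc (toℕ k)) (suc n)))
        ≈⟨ sum-cong-≋ (λ k → trans (sym (×-comm-* (suc n) _ _)) (*-cong (r≈ k) (D-dividedPower w (toℕ k) n))) ⟩
      ∑[ k < suc K ] (((toℕ k !) · D v (toℕ k)) * (D w ⊛ dividedPower w (toℕ k)) n)
        ≈⟨ ⊛-linear-sum (D w) (λ k → (toℕ k !) · D v (toℕ k)) (λ (k : Fin (suc K)) → dividedPower w (toℕ k)) n ⟨
      (D w ⊛ compose K (D v) w) n ∎
      where
      r : Vector Carrier (suc K)
      r k = (suc (toℕ k) !) · v (suc (toℕ k))
      r≈ : ∀ k → r k ≈ (toℕ k !) · D v (toℕ k)
      r≈ k = trans (sym (×-assocˡ _ (suc (toℕ k)) (toℕ k !))) (·-comm (suc (toℕ k)) (toℕ k !) _)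

    compose-D : ∀ K {v v' w w' x : ℕ → Carrier} → (∀ n → x n ≈ compose (suc K) v w n) →
                (∀ n → v' n ≈ D v n) → (∀ n → w' n ≈ D w n) →
                ∀ n → D x n ≈ (w' ⊛ compose K v' w) n
    compose-D K {v} {v'} {w} {w'} x≈ v'≈ w'≈ n = trans (D-cong x≈ n) (trans (D-compose K v w n)
      (sym (⊛-cong w'≈ (λ j → sum-cong-≋ λ (k : Fin (suc K)) → *-congʳ {dividedPower w (toℕ k) j} (·-congʳ (toℕ k !) (v'≈ (toℕ k)))) n)))

    antiderivative : Carrier → (ℕ → Carrier) → ℕ → Carrier
    antiderivative c v zero    = c
    antiderivative c v (suc n) = recip n * v n

    D-antiderivative : ∀ c v n → v n ≈ D (antiderivative c v) n
    D-antiderivative c v n = sym (suc·recip n (v n))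

    !·D : ∀ {v v' : ℕ → Carrier} n → (∀ j → v' j ≈ D v j) → (n !) · v' n ≈ (suc n !) · v (suc n)
    !·D {v} n v'≈ = trans (·-congʳ (n !) (v'≈ n))
      (trans (·-comm (n !) (suc n) (v (suc n))) (×-assocˡ (v (suc n)) (suc n) (n !)))

    -- Bell polynomials

    dpow : Carrier → ℕ → Carrier
    dpow x a = invFact a * x ^ a

    dpow-zero : ∀ x → dpow x 0 ≈ 1#
    dpow-zero x = trans (*-identityʳ _) (trans (sym (×-homo-1 _)) (inverse 0))

    suc·dpow : ∀ x a → suc a · dpow x (suc a) ≈ x * dpow x a
    suc·dpow x a = begin
      suc a · (invFact (suc a) * (x * x ^ a))   ≈⟨ ×-assoc-* (suc a) _ _ ⟨
      (suc a · invFact (suc a)) * (x * x ^ a)   ≈⟨ *-congʳ (suc·invFact a) ⟩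
      invFact a * (x * x ^ a)
        ≈⟨ solve 3 (λ i x y → i :* (x :* y) := x :* (i :* y)) refl (invFact a) x (x ^ a) ⟩
      x * dpow x a                              ∎

    -- The sum of ∏ xᵢ^κᵢ / κᵢ! · h (∑ ωᵢ κᵢ) (∑ κᵢ) over all κ with entries at most b.
    moment : ∀ m → Vector ℕ m → Vector Carrier m → ℕ → (ℕ → ℕ → Carrier) → Carrier
    moment zero    ω x b h = h 0 0
    moment (suc m) ω x b h = ∑[ a < suc b ]
      (dpow (x zero) (toℕ a) *
       moment m (tail ω) (tail x) b λ p q → h (ω zero ℕ.* toℕ a ℕ.+ p) (toℕ a ℕ.+ q))

    moment-cong : ∀ m ω x b {h h' : ℕ → ℕ → Carrier} → (∀ p q → h p q ≈ h' p q) → moment m ω x b h ≈ moment m ω x b h'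
    moment-cong zero    ω x b h≈ = h≈ 0 0
    moment-cong (suc m) ω x b h≈ = sum-cong-≋ λ (a : Fin (suc b)) →
      *-congˡ {dpow (x zero) (toℕ a)} (moment-cong m (tail ω) (tail x) b λ p q → h≈ (ω zero ℕ.* toℕ a ℕ.+ p) (toℕ a ℕ.+ q))

    moment-zero : ∀ m ω x b {h : ℕ → ℕ → Carrier} → (∀ p q → h p q ≈ 0#) → moment m ω x b h ≈ 0#
    moment-zero zero    ω x b h≈0 = h≈0 0 0
    moment-zero (suc m) ω x b {h} h≈0 = sum-zero
      (λ (a : Fin (suc b)) → dpow (x zero) (toℕ a) *
        moment m (tail ω) (tail x) b λ p q → h (ω zero ℕ.* toℕ a ℕ.+ p) (toℕ a ℕ.+ q))
      λ a → trans (*-congˡ (moment-zero m (tail ω) (tail x) b λ p q → h≈0 (ω zero ℕ.* toℕ a ℕ.+ p) (toℕ a ℕ.+ q)))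
                  (zeroʳ _)

    moment-+ : ∀ m ω x b h h' →
               moment m ω x b (λ p q → h p q + h' p q) ≈ moment m ω x b h + moment m ω x b h'
    moment-+ zero    ω x b h h' = refl
    moment-+ (suc m) ω x b h h' = trans
      (sum-cong-≋ λ (a : Fin (suc b)) →
        trans (*-congˡ {dpow (x zero) (toℕ a)} (moment-+ m (tail ω) (tail x) b (shift h a) (shift h' a))) (distribˡ _ _ _))
      (∑-distrib-+ (λ a → dpow (x zero) (toℕ a) * moment m (tail ω) (tail x) b (shift h a))
                   (λ a → dpow (x zero) (toℕ a) * moment m (tail ω) (tail x) b (shift h' a)))
      where
      shift : (ℕ → ℕ → Carrier) → Fin (suc b) → ℕ → ℕ → Carrier
      shift h a p q = h (ω zero ℕ.* toℕ a ℕ.+ p) (toℕ a ℕ.+ q)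

    moment-· : ∀ m ω x b n h → moment m ω x b (λ p q → n · h p q) ≈ n · moment m ω x b h
    moment-· m ω x b zero    h = moment-zero m ω x b λ p q → refl
    moment-· m ω x b (suc n) h =
      trans (moment-+ m ω x b h (λ p q → n · h p q)) (+-congˡ (moment-· m ω x b n h))

    sum-last : ∀ n (f : ℕ → Carrier) → ∑[ a < suc n ] f (toℕ a) ≈ ∑[ a < n ] f (toℕ a) + f n
    sum-last n f = trans (sum-init-last {n} (λ a → f (toℕ a)))
      (+-cong (sum-cong-≋ λ (a : Fin n) → reflexive (≡.cong f (Fin.toℕ-inject₁ a)))
              (reflexive (≡.cong f (Fin.toℕ-fromℕ n))))

    -- Weighting by p is the Euler operator t d/dt, applied to ∏ᵢ exp (xᵢ t^ωᵢ); truncating the exponents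
    -- at b does no harm because h vanishes beyond.
    euler : ∀ m ω x b (h : ℕ → ℕ → Carrier) → (∀ p q → b ℕ.< q → h p q ≈ 0#) →
            moment m ω x b (λ p q → p · h p q) ≈
            ∑[ i < m ] ((ω i · x i) * moment m ω x b (λ p q → h (ω i ℕ.+ p) (suc q)))
    euler zero    ω x b h h≈0 = refl
    euler (suc m) ω x b h h≈0 = begin
      ∑[ a < suc b ] (e (toℕ a) * M (λ p q → (ω₀ ℕ.* toℕ a ℕ.+ p) · shift (toℕ a) p q))
        ≈⟨ sum-cong-≋ (λ (a : Fin (suc b)) → split (toℕ a)) ⟩
      ∑[ a < suc b ] (head-part (toℕ a) + tail-part (toℕ a))
        ≈⟨ ∑-distrib-+ {suc b} (λ a → head-part (toℕ a)) (λ a → tail-part (toℕ a)) ⟩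
      ∑[ a < suc b ] head-part (toℕ a) + ∑[ a < suc b ] tail-part (toℕ a)
        ≈⟨ +-cong head-sum tail-sum ⟩
      ∑[ i < suc m ] ((ω i · x i) * moment (suc m) ω x b (λ p q → h (ω i ℕ.+ p) (suc q))) ∎
      where
      ω₀ = ω zero
      x₀ = x zero
      e = dpow x₀
      M = moment m (tail ω) (tail x) b
      shift : ℕ → ℕ → ℕ → Carrier
      shift a p q = h (ω₀ ℕ.* a ℕ.+ p) (a ℕ.+ q)
      r : Fin m → Carrier
      r i = ω (suc i) · x (suc i)
      head-part tail-part : ℕ → Carrier
      head-part a = e a * ((ω₀ ℕ.* a) · M (shift a))
      tail-part a = e a * ∑[ i < m ] (r i * M (λ p q → shift a (ω (suc i) ℕ.+ p) (suc q)))

      split : ∀ a → e a * M (λ p q → (ω₀ ℕ.* a ℕ.+ p) · shift a p q) ≈ head-part a + tail-part a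
      split a = begin
        e a * M (λ p q → (ω₀ ℕ.* a ℕ.+ p) · shift a p q)
          ≈⟨ *-congˡ (moment-cong m (tail ω) (tail x) b λ p q → ×-homo-+ (shift a p q) (ω₀ ℕ.* a) p) ⟩
        e a * M (λ p q → (ω₀ ℕ.* a) · shift a p q + p · shift a p q)
          ≈⟨ *-congˡ (moment-+ m (tail ω) (tail x) b (λ p q → (ω₀ ℕ.* a) · shift a p q) (λ p q → p · shift a p q)) ⟩
        e a * (M (λ p q → (ω₀ ℕ.* a) · shift a p q) + M (λ p q → p · shift a p q))
          ≈⟨ *-congˡ (+-cong (moment-· m (tail ω) (tail x) b (ω₀ ℕ.* a) (shift a))
               (euler m (tail ω) (tail x) b (shift a) λ p q b<q →
                 h≈0 (ω₀ ℕ.* a ℕ.+ p) (a ℕ.+ q) (ℕ.<-≤-trans b<q (ℕ.m≤n+m q a)))) ⟩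
        e a * ((ω₀ ℕ.* a) · M (shift a) + ∑[ i < m ] (r i * M (λ p q → shift a (ω (suc i) ℕ.+ p) (suc q))))
          ≈⟨ distribˡ _ _ _ ⟩
        head-part a + tail-part a ∎

      next-term : ℕ → Carrier
      next-term a = e a * M (shift (suc a))

      head-suc : ∀ a → head-part (suc a) ≈ (ω₀ · x₀) * next-term a
      head-suc a = begin
        e (suc a) * ((ω₀ ℕ.* suc a) · M (shift (suc a)))
          ≈⟨ *-congˡ (×-assocˡ _ ω₀ (suc a)) ⟨
        e (suc a) * (ω₀ · (suc a · M (shift (suc a))))
          ≈⟨ ×-comm-* ω₀ _ _ ⟩
        ω₀ · (e (suc a) * (suc a · M (shift (suc a))))
          ≈⟨ ·-congʳ ω₀ (trans (×-comm-* (suc a) _ _) (sym (×-assoc-* (suc a) _ _))) ⟩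
        ω₀ · ((suc a · e (suc a)) * M (shift (suc a)))
          ≈⟨ ·-congʳ ω₀ (trans (*-congʳ (suc·dpow x₀ a)) (*-assoc _ _ _)) ⟩
        ω₀ · (x₀ * next-term a)
          ≈⟨ ×-assoc-* ω₀ _ _ ⟨
        (ω₀ · x₀) * next-term a ∎

      last-vanishes : next-term b ≈ 0#
      last-vanishes = trans (*-congˡ (moment-zero m (tail ω) (tail x) b λ p q →
        h≈0 (ω₀ ℕ.* suc b ℕ.+ p) (suc b ℕ.+ q) (ℕ.m≤m+n (suc b) q))) (zeroʳ _)

      head-sum : ∑[ a < suc b ] head-part (toℕ a) ≈
                 (ω₀ · x₀) * moment (suc m) ω x b (λ p q → h (ω₀ ℕ.+ p) (suc q))
      head-sum = begin
        head-part 0 + ∑[ a < b ] head-part (suc (toℕ a))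
          ≈⟨ +-cong (trans (*-congˡ (×-congˡ (ℕ.*-zeroʳ ω₀))) (zeroʳ _))
                    (sum-cong-≋ λ (a : Fin b) → head-suc (toℕ a)) ⟩
        0# + ∑[ a < b ] ((ω₀ · x₀) * next-term (toℕ a))
          ≈⟨ trans (+-identityˡ _) (sym (*-distribˡ-sum {b} (ω₀ · x₀) (λ a → next-term (toℕ a)))) ⟩
        (ω₀ · x₀) * ∑[ a < b ] next-term (toℕ a)
          -- Lowering the exponent leaves only a < b; adding the vanishing term a = b restores the
          -- full range of `moment`.
          ≈⟨ *-congˡ (trans (sum-last b next-term) (trans (+-congˡ last-vanishes) (+-identityʳ _))) ⟨
        (ω₀ · x₀) * ∑[ a < suc b ] next-term (toℕ a)
          ≈⟨ *-congˡ (sum-cong-≋ λ (a : Fin (suc b)) → *-congˡ {e (toℕ a)} (moment-cong m (tail ω) (tail x) b λ p q →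
               reflexive (≡.cong (λ z → h z (suc (toℕ a ℕ.+ q)))
                 (≡.trans (≡.cong (ℕ._+ p) (ℕ.*-suc ω₀ (toℕ a))) (ℕ.+-assoc ω₀ _ p))))) ⟩
        (ω₀ · x₀) * moment (suc m) ω x b (λ p q → h (ω₀ ℕ.+ p) (suc q)) ∎

      tail-sum : ∑[ a < suc b ] tail-part (toℕ a) ≈
                 ∑[ i < m ] (r i * moment (suc m) ω x b (λ p q → h (ω (suc i) ℕ.+ p) (suc q)))
      tail-sum = begin
        ∑[ a < suc b ] tail-part (toℕ a)
          ≈⟨ sum-cong-≋ (λ (a : Fin (suc b)) → *-distribˡ-sum {m} (e (toℕ a)) (λ i → r i * H a i)) ⟩
        ∑[ a < suc b ] (∑[ i < m ] (e (toℕ a) * (r i * H a i)))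
          ≈⟨ ∑-comm {suc b} {m} (λ a i → e (toℕ a) * (r i * H a i)) ⟩
        ∑[ i < m ] (∑[ a < suc b ] (e (toℕ a) * (r i * H a i)))
          ≈⟨ sum-cong-≋ (λ (i : Fin m) → trans
               (sum-cong-≋ λ (a : Fin (suc b)) →
                 solve 3 (λ x y z → x :* (y :* z) := y :* (x :* z)) refl (e (toℕ a)) (r i) (H a i))
               (sym (*-distribˡ-sum {suc b} (r i) (λ a → e (toℕ a) * H a i)))) ⟩
        ∑[ i < m ] (r i * ∑[ a < suc b ] (e (toℕ a) * H a i))
          ≈⟨ sum-cong-≋ (λ (i : Fin m) → *-congˡ {r i} (sum-cong-≋ λ (a : Fin (suc b)) → *-congˡ {e (toℕ a)}
               (moment-cong m (tail ω) (tail x) b λ p q → reflexive (≡.cong₂ h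
                 (swap (ω₀ ℕ.* toℕ a) (ω (suc i)) p) (ℕ.+-suc (toℕ a) q))))) ⟩
        ∑[ i < m ] (r i * moment (suc m) ω x b (λ p q → h (ω (suc i) ℕ.+ p) (suc q))) ∎
        where
        H : Fin (suc b) → Fin m → Carrier
        H a i = M (λ p q → shift (toℕ a) (ω (suc i) ℕ.+ p) (suc q))
        swap : ∀ i j k → i ℕ.+ (j ℕ.+ k) ≡ j ℕ.+ (i ℕ.+ k)
        swap i j k = ≡.trans (≡.sym (ℕ.+-assoc i j k))
          (≡.trans (≡.cong (ℕ._+ k) (ℕ.+-comm i j)) (ℕ.+-assoc j i k))

    -- The Kronecker delta, by recursion so that `δ (suc n) (suc i ℕ.+ p)` computes to
    -- `δ n (i ℕ.+ p)`: the shifts produced by `euler` then need no rewriting.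
    δ : ℕ → ℕ → Carrier
    δ zero    zero    = 1#
    δ zero    (suc _) = 0#
    δ (suc _) zero    = 0#
    δ (suc m) (suc n) = δ m n

    δ-≡ : ∀ m {n} → n ≡ m → δ m n ≈ 1#
    δ-≡ zero    ≡.refl = refl
    δ-≡ (suc m) ≡.refl = δ-≡ m ≡.refl

    δ-≢ : ∀ m n → ¬ n ≡ m → δ m n ≈ 0#
    δ-≢ zero    zero    n≢m = contradiction ≡.refl n≢m
    δ-≢ zero    (suc n) _   = refl
    δ-≢ (suc m) zero    _   = refl
    δ-≢ (suc m) (suc n) n≢m = δ-≢ m n (n≢m ∘ ≡.cong suc)

    -- `δ m n` vanishes unless m = n. This trades a fixed factor for the weight p of the summand,
    -- which is what `euler` can process.
    δ-·-swap : ∀ m n z → m · (δ m n * z) ≈ n · (δ m n * z)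
    δ-·-swap zero    zero    z = refl
    δ-·-swap zero    (suc n) z = sym (trans (·-congʳ (suc n) (zeroˡ z)) (·-zeroʳ (suc n)))
    δ-·-swap (suc m) zero    z = trans (·-congʳ (suc m) (zeroˡ z)) (·-zeroʳ (suc m))
    δ-·-swap (suc m) (suc n) z = +-congˡ (δ-·-swap m n z)

    -- All weights `suc (ω i)` are positive, so total weight 0 leaves only κ = 0, with monomial 1
    -- and exponent sum 0.
    moment-weight-zero : ∀ m ω x b k → moment m (suc ∘ ω) x b (λ p q → δ 0 p * δ k q) ≈ δ k 0
    moment-weight-zero zero    ω x b k = *-identityˡ (δ k 0)
    moment-weight-zero (suc m) ω x b k = begin
      dpow (x zero) 0 * moment m (suc ∘ tail ω) (tail x) b (λ p q → δ 0 (ω zero ℕ.* 0 ℕ.+ p) * δ k q)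
        + ∑[ a < b ] (dpow (x zero) (suc (toℕ a)) * rest a)
        ≈⟨ +-cong (*-cong (dpow-zero (x zero)) (moment-cong m _ (tail x) b λ p q →
                    *-congʳ (reflexive (≡.cong (λ z → δ 0 (z ℕ.+ p)) (ℕ.*-zeroʳ (ω zero))))))
             (sum-zero (λ (a : Fin b) → dpow (x zero) (suc (toℕ a)) * rest a)
               λ a → trans (*-congˡ (moment-zero m _ (tail x) b λ p q → zeroˡ _)) (zeroʳ _)) ⟩
      1# * moment m (suc ∘ tail ω) (tail x) b (λ p q → δ 0 p * δ k q) + 0#
        ≈⟨ trans (+-identityʳ _) (*-identityˡ _) ⟩
      moment m (suc ∘ tail ω) (tail x) b (λ p q → δ 0 p * δ k q)
        ≈⟨ moment-weight-zero m (tail ω) (tail x) b k ⟩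
      δ k 0 ∎
      where
      rest : Fin b → Carrier
      rest a = moment m (suc ∘ tail ω) (tail x) b λ p q →
        δ 0 (suc (ω zero) ℕ.* suc (toℕ a) ℕ.+ p) * δ k (suc (toℕ a) ℕ.+ q)

    -- e (n − i), or 0 when n < i.
    _↓_,_ : (ℕ → Carrier) → ℕ → ℕ → Carrier
    e ↓ n     , zero  = e n
    e ↓ zero  , suc i = 0#
    e ↓ suc n , suc i = e ↓ n , i

    ↓-cong : ∀ {e e'} n i → (∀ j → j ℕ.≤ n → e j ≈ e' j) → e ↓ n , i ≈ e' ↓ n , i
    ↓-cong n       zero    e≈ = e≈ n ℕ.≤-refl
    ↓-cong zero    (suc i) e≈ = refl
    ↓-cong (suc n) (suc i) e≈ = ↓-cong n i λ j j≤n → e≈ j (ℕ.m≤n⇒m≤1+n j≤n)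

    ↓-order : ∀ {e} k n i → (∀ j → j ℕ.< k → e j ≈ 0#) → n ℕ.< i ℕ.+ k → e ↓ n , i ≈ 0#
    ↓-order k n       zero    e≈0 n<k       = e≈0 n n<k
    ↓-order k zero    (suc i) e≈0 _         = refl
    ↓-order k (suc n) (suc i) e≈0 (s≤s n<i+k) = ↓-order k n i e≈0 n<i+k

    -- If m exceeds n+1, the extra terms are 0 by the convention for `_↓_,_`; if m is smaller, the
    -- hypothesis makes the missing terms of the Cauchy product vanish.
    sum-↓ : ∀ m n v e → (∀ i → m ℕ.≤ i → e ↓ n , i ≈ 0#) →
            ∑[ i < m ] (v (toℕ i) * (e ↓ n , toℕ i)) ≈ (v ⊛ e) n
    sum-↓ zero    zero    v e e≈0 = sym (trans (*-congˡ (e≈0 0 z≤n)) (zeroʳ _))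
    sum-↓ zero    (suc n) v e e≈0 = begin
      0#                                    ≈⟨ sum-↓ zero n (v ∘ suc) e (λ i _ → e≈0 (suc i) z≤n) ⟩
      (v ∘ suc ⊛ e) n                       ≈⟨ +-identityˡ _ ⟨
      0# + (v ∘ suc ⊛ e) n                  ≈⟨ +-congʳ (trans (*-congˡ (e≈0 0 z≤n)) (zeroʳ _)) ⟨
      v 0 * e (suc n) + (v ∘ suc ⊛ e) n     ∎
    sum-↓ (suc m) zero    v e e≈0 = trans
      (+-congˡ (sum-zero (λ (i : Fin m) → v (suc (toℕ i)) * 0#) λ i → zeroʳ _)) (+-identityʳ _)
    sum-↓ (suc m) (suc n) v e e≈0 = +-congˡ (sum-↓ m n (v ∘ suc) e λ i m≤i → e≈0 (suc i) (s≤s m≤i))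

    moment-↓ : ∀ m ω x b n i k →
               moment m ω x b (λ p q → δ n (i ℕ.+ p) * δ k q) ≈
               (λ j → moment m ω x b (λ p q → δ j p * δ k q)) ↓ n , i
    moment-↓ m ω x b n       zero    k = refl
    moment-↓ m ω x b zero    (suc i) k = moment-zero m ω x b λ p q → zeroˡ _
    moment-↓ m ω x b (suc n) (suc i) k = moment-↓ m ω x b n i k

    -- Both sides satisfy (n+1) e (k+1) (n+1) = ∑ᵢ (i+1) w (i+1) · e k (n−i); the bound on m
    -- guarantees that the indices missing from the moment contribute nothing.
    moment-dividedPower : ∀ m b x w → (∀ i → x i ≈ w (suc (toℕ i))) → ∀ k n → k ℕ.≤ b → n ℕ.< m ℕ.+ k →
      moment m (suc ∘ toℕ) x b (λ p q → δ n p * δ k q) ≈ dividedPower w k n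
    moment-dividedPower m b x w x≈w zero    zero    _   _     = moment-weight-zero m toℕ x b 0
    moment-dividedPower m b x w x≈w (suc k) zero    _   _     = moment-weight-zero m toℕ x b (suc k)
    moment-dividedPower m b x w x≈w zero    (suc n) _   _     = suc·-cancel n (begin
      suc n · M (λ p q → δ (suc n) p * δ 0 q)
        ≈⟨ moment-· m (suc ∘ toℕ) x b (suc n) (λ p q → δ (suc n) p * δ 0 q) ⟨
      M (λ p q → suc n · (δ (suc n) p * δ 0 q))
        ≈⟨ moment-cong m (suc ∘ toℕ) x b (λ p q → δ-·-swap (suc n) p (δ 0 q)) ⟩
      M (λ p q → p · (δ (suc n) p * δ 0 q))
        ≈⟨ euler m (suc ∘ toℕ) x b (λ p q → δ (suc n) p * δ 0 q) (λ { p (suc q) _ → zeroʳ _ }) ⟩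
      ∑[ i < m ] ((suc (toℕ i) · x i) * M (λ p q → δ n (toℕ i ℕ.+ p) * 0#))
        ≈⟨ sum-zero (λ (i : Fin m) → (suc (toℕ i) · x i) * M (λ p q → δ n (toℕ i ℕ.+ p) * 0#))
             (λ i → trans (*-congˡ (moment-zero m (suc ∘ toℕ) x b λ p q → zeroʳ _)) (zeroʳ _)) ⟩
      0#
        ≈⟨ ·-zeroʳ (suc n) ⟨
      suc n · 0# ∎)
      where M = moment m (suc ∘ toℕ) x b
    moment-dividedPower m b x w x≈w (suc k) (suc n) k<b n<m+k = suc·-cancel n (begin
      suc n · M (λ p q → δ (suc n) p * δ (suc k) q)
        ≈⟨ moment-· m (suc ∘ toℕ) x b (suc n) (λ p q → δ (suc n) p * δ (suc k) q) ⟨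
      M (λ p q → suc n · (δ (suc n) p * δ (suc k) q))
        ≈⟨ moment-cong m (suc ∘ toℕ) x b (λ p q → δ-·-swap (suc n) p (δ (suc k) q)) ⟩
      M (λ p q → p · (δ (suc n) p * δ (suc k) q))
        -- The cut-off condition holds because q > b ≥ k+1 rules out q = k+1.
        ≈⟨ euler m (suc ∘ toℕ) x b (λ p q → δ (suc n) p * δ (suc k) q) (λ p q b<q →
             trans (*-congˡ (δ-≢ (suc k) q λ q≡ → ℕ.<⇒≱ b<q (ℕ.≤-trans (ℕ.≤-reflexive q≡) k<b))) (zeroʳ _)) ⟩
      ∑[ i < m ] ((suc (toℕ i) · x i) * M (λ p q → δ n (toℕ i ℕ.+ p) * δ k q))
        ≈⟨ sum-cong-≋ (λ (i : Fin m) → *-cong (·-congʳ (suc (toℕ i)) (x≈w i))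
             (trans (moment-↓ m (suc ∘ toℕ) x b n (toℕ i) k)
                    (↓-cong n (toℕ i) λ j j≤n →
                      moment-dividedPower m b x w x≈w k j (ℕ.<⇒≤ k<b) (ℕ.≤-<-trans j≤n n<m+k')))) ⟩
      ∑[ i < m ] (D w (toℕ i) * (dividedPower w k ↓ n , toℕ i))
        ≈⟨ sum-↓ m n (D w) (dividedPower w k) (λ i m≤i →
             ↓-order k n i (dividedPower-order w k) (ℕ.<-≤-trans n<m+k' (ℕ.+-monoˡ-≤ k m≤i))) ⟩
      (D w ⊛ dividedPower w k) n
        ≈⟨ D-dividedPower w k n ⟨
      suc n · dividedPower w (suc k) (suc n) ∎)
      where
      M = moment m (suc ∘ toℕ) x b
      n<m+k' : n ℕ.< m ℕ.+ k
      n<m+k' = ℕ.s<s⁻¹ (≡.subst (suc n ℕ.<_) (ℕ.+-suc m k) n<m+k)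

    -- Sums over lists of exponent vectors

    listSum : ∀ {a} {A : Set a} → (A → Carrier) → List A → Carrier
    listSum φ xs = List.foldr _+_ 0# (List.map φ xs)

    listSum-cong : ∀ {a} {A : Set a} {φ ψ : A → Carrier} → (∀ y → φ y ≈ ψ y) → ∀ xs → listSum φ xs ≈ listSum ψ xs
    listSum-cong φ≈ []       = refl
    listSum-cong φ≈ (y ∷ xs) = +-cong (φ≈ y) (listSum-cong φ≈ xs)

    listSum-*ˡ : ∀ {a} {A : Set a} z (φ : A → Carrier) xs → listSum (λ y → z * φ y) xs ≈ z * listSum φ xs
    listSum-*ˡ z φ []       = sym (zeroʳ z)
    listSum-*ˡ z φ (y ∷ xs) = trans (+-congˡ (listSum-*ˡ z φ xs)) (sym (distribˡ z _ _))

    listSum-map-++ : ∀ {a b} {A : Set a} {B : Set b} (φ : B → Carrier) (g : A → B) xs ys →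
                     listSum φ (List.map g xs ++ ys) ≈ listSum (φ ∘ g) xs + listSum φ ys
    listSum-map-++ φ g []       ys = sym (+-identityˡ _)
    listSum-map-++ φ g (x ∷ xs) ys = trans (+-congˡ (listSum-map-++ φ g xs ys)) (sym (+-assoc _ _ _))

    listSum-cartesianProductWith :
      ∀ {a b c} {A : Set a} {B : Set b} {C : Set c} (φ : C → Carrier) (g : A → B → C) xs ys →
      listSum φ (cartesianProductWith g xs ys) ≈ listSum (λ x → listSum (λ y → φ (g x y)) ys) xs
    listSum-cartesianProductWith φ g []       ys = refl
    listSum-cartesianProductWith φ g (x ∷ xs) ys =
      trans (listSum-map-++ φ (g x) ys _) (+-congˡ (listSum-cartesianProductWith φ g xs ys))

    listSum-applyUpTo : ∀ {a} {A : Set a} (φ : A → Carrier) (g : ℕ → A) n →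
                        listSum φ (applyUpTo g n) ≡ ∑[ i < n ] φ (g (toℕ i))
    listSum-applyUpTo φ g zero    = ≡.refl
    listSum-applyUpTo φ g (suc n) = ≡.cong (φ (g 0) +_) (listSum-applyUpTo φ (g ∘ suc) n)

    -- An indicator factor χ in place of the filter turns membership in `Λ` into the function h of
    -- `moment`.
    listSum-filter : ∀ {a p} {A : Set a} {P : Pred A p} (P? : Decidable P) (φ χ : A → Carrier) →
                     (∀ y → P y → χ y ≈ 1#) → (∀ y → ¬ P y → χ y ≈ 0#) → ∀ xs →
                     listSum φ (filter P? xs) ≈ listSum (λ y → φ y * χ y) xs
    listSum-filter P? φ χ χ≈1 χ≈0 []       = refl
    listSum-filter P? φ χ χ≈1 χ≈0 (y ∷ xs) with P? y
    ... | yes Py = +-cong (sym (trans (*-congˡ (χ≈1 y Py)) (*-identityʳ _))) (listSum-filter P? φ χ χ≈1 χ≈0 xs)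
    ... | no ¬Py = trans (listSum-filter P? φ χ χ≈1 χ≈0 xs)
      (sym (trans (+-congʳ (trans (*-congˡ (χ≈0 y ¬Py)) (zeroʳ _))) (+-identityˡ _)))

    monomial : ∀ {m} → Vector Carrier m → Vec ℕ m → Carrier
    monomial x κ = product λ i → dpow (x i) (lookup κ i)

    monomial-≈ : ∀ {m} x (κ : Vec ℕ m) (z : Vector Carrier m) → (∀ i → dpow (x i) (lookup κ i) ≈ z i) →
                 monomial x κ ≈ product z
    monomial-≈ x κ z = product-cong

    weighted : ∀ {m} → Vector ℕ m → Vec ℕ m → ℕ
    weighted ω κ = Vec.sum (Vec.tabulate λ i → ω i ℕ.* lookup κ i)

    listSum-tuples : ∀ m ω x b h →
      listSum (λ κ → monomial x κ * h (weighted ω κ) (Vec.sum κ)) (tuples m b) ≈ moment m ω x b h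
    listSum-tuples zero    ω x b h = trans (+-identityʳ _) (*-identityˡ _)
    listSum-tuples (suc m) ω x b h = begin
      listSum φ (cartesianProductWith _∷_ (upTo (suc b)) (tuples m b))
        ≈⟨ listSum-cartesianProductWith φ _∷_ (upTo (suc b)) (tuples m b) ⟩
      listSum (λ a → listSum (λ κ → φ (a ∷ κ)) (tuples m b)) (upTo (suc b))
        ≡⟨ listSum-applyUpTo (λ a → listSum (λ κ → φ (a ∷ κ)) (tuples m b)) id (suc b) ⟩
      ∑[ a < suc b ] (listSum (λ κ → φ (toℕ a ∷ κ)) (tuples m b))
        ≈⟨ sum-cong-≋ (λ (a : Fin (suc b)) → trans
             (trans (listSum-cong (λ κ → *-assoc _ _ _) (tuples m b)) (listSum-*ˡ (dpow (x zero) (toℕ a)) (λ κ → monomial (tail x) κ * h (ω zero ℕ.* toℕ a ℕ.+ weighted (tail ω) κ) (toℕ a ℕ.+ Vec.sum κ)) (tuples m b)))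
             (*-congˡ {dpow (x zero) (toℕ a)} (listSum-tuples m (tail ω) (tail x) b λ p q → h (ω zero ℕ.* toℕ a ℕ.+ p) (toℕ a ℕ.+ q)))) ⟩
      moment (suc m) ω x b h ∎
      where
      φ : Vec ℕ (suc m) → Carrier
      φ κ = monomial x κ * h (weighted ω κ) (Vec.sum κ)

    listSum-Λ : ∀ n k x w → k ℕ.≤ n → (∀ i → x i ≈ w (suc (toℕ i))) →
      listSum (monomial x) (Λ n k) ≈ dividedPower w k n
    listSum-Λ n k x w k≤n x≈w = begin
      listSum (monomial x) (Λ n k)
        ≈⟨ listSum-filter (λ κ → (Vec.sum κ ℕ.≟ k) ×-dec (weight κ ℕ.≟ n)) (monomial x)
             (λ κ → δ n (weight κ) * δ k (Vec.sum κ))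
             (λ { κ (sum≡k , weight≡n) → trans (*-cong (δ-≡ n weight≡n) (δ-≡ k sum≡k)) (*-identityˡ 1#) })
             (λ κ ¬P → vanish κ ¬P (Vec.sum κ ℕ.≟ k)) (tuples (suc (n ℕ.∸ k)) k) ⟩
      listSum (λ κ → monomial x κ * (δ n (weight κ) * δ k (Vec.sum κ))) (tuples (suc (n ℕ.∸ k)) k)
        ≈⟨ listSum-tuples (suc (n ℕ.∸ k)) (suc ∘ toℕ) x k (λ p q → δ n p * δ k q) ⟩
      moment (suc (n ℕ.∸ k)) (suc ∘ toℕ) x k (λ p q → δ n p * δ k q)
        -- The number of variables is the least allowed: n < m + k with m = n - k + 1 holds with
        -- nothing to spare. Entries up to k are likewise just enough.
        ≈⟨ moment-dividedPower (suc (n ℕ.∸ k)) k x w x≈w k n ℕ.≤-refl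
             (s≤s (ℕ.≤-reflexive (≡.sym (ℕ.m∸n+n≡m k≤n)))) ⟩
      dividedPower w k n ∎
      where
      vanish : ∀ (κ : Vec ℕ (suc (n ℕ.∸ k))) → ¬ (Vec.sum κ ≡ k × weight κ ≡ n) → Dec (Vec.sum κ ≡ k) →
               δ n (weight κ) * δ k (Vec.sum κ) ≈ 0#
      vanish κ ¬P (yes sum≡k) = trans (*-congʳ (δ-≢ n _ λ weight≡n → ¬P (sum≡k , weight≡n))) (zeroˡ _)
      vanish κ ¬P (no sum≢k)  = trans (*-congˡ (δ-≢ k _ sum≢k)) (zeroʳ _)

    -- The index of x is off by one: `x k` carries the arguments for the Bell polynomial of index
    -- k+1, whose length fits since `suc n ∸ suc k` computes to `n ∸ k`.
    compose-Λ : ∀ n v w (x : ∀ k → Vector Carrier (suc (n ℕ.∸ k))) → (∀ k i → x k i ≈ w (suc (toℕ i))) →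
      (y : Vector Carrier (suc n)) →
      (∀ i → y i ≈ ((suc n !) · listSum (monomial (x (toℕ i))) (Λ (suc n) (suc (toℕ i)))) *
                   ((suc (toℕ i) !) · v (suc (toℕ i)))) →
      (suc n !) · compose (suc n) v w (suc n) ≈ sum y
    compose-Λ n v w x x≈w y y≈ = begin
      -- The term k = 0 is a constant series and contributes nothing to a coefficient of positive
      -- index, so the final sum starts at k = 1.
      (suc n !) · ((1 · v 0) * 0# + ∑[ i < suc n ] (r i * e i))
        ≈⟨ ·-congʳ (suc n !) (trans (+-congʳ (zeroʳ _)) (+-identityˡ _)) ⟩
      (suc n !) · (∑[ i < suc n ] (r i * e i))
        ≈⟨ ·-distrib-sum (suc n !) (λ i → r i * e i) ⟩
      ∑[ i < suc n ] ((suc n !) · (r i * e i))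
        ≈⟨ sum-cong-≋ (λ (i : Fin (suc n)) → begin
             (suc n !) · (r i * e i)     ≈⟨ ·-congʳ (suc n !) (*-comm (r i) (e i)) ⟩
             (suc n !) · (e i * r i)     ≈⟨ ×-assoc-* (suc n !) (e i) (r i) ⟨
             ((suc n !) · e i) * r i     ≈⟨ *-congʳ (·-congʳ (suc n !) (listSum-Λ (suc n) (suc (toℕ i))
                                              (x (toℕ i)) w (Fin.toℕ<n i) (x≈w (toℕ i)))) ⟨
             ((suc n !) · listSum (monomial (x (toℕ i))) (Λ (suc n) (suc (toℕ i)))) * r i
                                         ≈⟨ y≈ i ⟨
             y i                         ∎) ⟩
      sum y ∎
      where
      r e : Fin (suc n) → Carrier
      r i = (suc (toℕ i) !) · v (suc (toℕ i))
      e i = dividedPower w (suc (toℕ i)) (suc n)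

open import Defs

-- Cauchy reals

Eventually : (ℕ → Set) → Set
Eventually P = ∃ λ M → ∀ n → M ℕ.≤ n → P n

eventually-map : ∀ {P Q : ℕ → Set} → (∀ n → P n → Q n) → Eventually P → Eventually Q
eventually-map f (M , p) = M , λ n M≤n → f n (p n M≤n)

eventually-× : ∀ {P Q R : ℕ → Set} → (∀ n → P n → Q n → R n) → Eventually P → Eventually Q → Eventually R
eventually-× f (M , p) (K , q) =
  M ℕ.⊔ K , λ n n≥ → f n (p n (ℕ.m⊔n≤o⇒m≤o M K n≥)) (q n (ℕ.m⊔n≤o⇒n≤o M K n≥))

pointwise : ∀ x y → (∀ n → seq x n ≡ seq y n) → x ≃ y
pointwise x y x≡y ε 0<ε = 0 , λ n _ →
  ≡.subst (ℚ._< ε) (≡.sym (≡.trans (≡.cong (λ z → dist z (seq y n)) (x≡y n)) (dist-self (seq y n)))) 0<ε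

≃-sym : ∀ {x y} → x ≃ y → y ≃ x
≃-sym {x} {y} x≃y ε 0<ε =
  eventually-map (λ n → ≡.subst (ℚ._< ε) (dist-sym (seq x n) (seq y n))) (x≃y ε 0<ε)

≃-trans : ∀ {x y z} → x ≃ y → y ≃ z → x ≃ z
≃-trans {x} {y} {z} x≃y y≃z ε 0<ε = eventually-×
  (λ n p q → ≡.subst₂ (λ s t → s ℚ.< t) (≡.cong ℚ.∣_∣ (telescope (seq x n) (seq y n) (seq z n))) (halves ε)
    (ℚ.≤-<-trans (ℚ.∣p+q∣≤∣p∣+∣q∣ (seq x n ℚ.- seq y n) (seq y n ℚ.- seq z n)) (ℚ.+-mono-< p q)))
  (x≃y (½ ℚ.* ε) (half-pos 0<ε)) (y≃z (½ ℚ.* ε) (half-pos 0<ε))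
  where
  open +-*-Solver
  telescope : ∀ a b c → (a ℚ.- b) ℚ.+ (b ℚ.- c) ≡ a ℚ.- c
  telescope = solve 3 (λ a b c → (a :- b) :+ (b :- c) := a :- c) ≡.refl

-- Sums and products are formed termwise, so each algebraic law is an identity of rationals at every
-- index.
ℝ-commutativeSemiring : CommutativeSemiring 0ℓ 0ℓ
ℝ-commutativeSemiring = record
  { Carrier = ℝ ; _≈_ = _≃_ ; _+_ = _+_ ; _*_ = _*_ ; 0# = 0ℝ ; 1# = 1ℝ
  ; isCommutativeSemiring = IsCommutativeSemiringˡ.isCommutativeSemiring record
    { +-isCommutativeMonoid = record
      { isMonoid = record
        { isSemigroup = record
          { isMagma = record
            { isEquivalence = isEquivalence
            ; ∙-cong = λ {x} {y} {u} {v} → +-cong {x} {y} {u} {v}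
            }
          ; assoc = λ x y z → pointwise ((x + y) + z) (x + (y + z)) λ n → ℚ.+-assoc (seq x n) (seq y n) (seq z n)
          }
        ; identity = (λ x → pointwise (0ℝ + x) x λ n → ℚ.+-identityˡ (seq x n))
                   , (λ x → pointwise (x + 0ℝ) x λ n → ℚ.+-identityʳ (seq x n))
        }
      ; comm = λ x y → pointwise (x + y) (y + x) λ n → ℚ.+-comm (seq x n) (seq y n)
      }
    ; *-isCommutativeMonoid = record
      { isMonoid = record
        { isSemigroup = record
          { isMagma = record
            { isEquivalence = isEquivalence
            ; ∙-cong = λ {x} {y} {u} {v} → *-cong {x} {y} {u} {v}
            }
          ; assoc = λ x y z → pointwise ((x * y) * z) (x * (y * z)) λ n → ℚ.*-assoc (seq x n) (seq y n) (seq z n)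
          }
        ; identity = (λ x → pointwise (1ℝ * x) x λ n → ℚ.*-identityˡ (seq x n))
                   , (λ x → pointwise (x * 1ℝ) x λ n → ℚ.*-identityʳ (seq x n))
        }
      ; comm = λ x y → pointwise (x * y) (y * x) λ n → ℚ.*-comm (seq x n) (seq y n)
      }
    ; distribʳ = λ x y z → pointwise ((y + z) * x) (y * x + z * x) λ n →
        ℚ.*-distribʳ-+ (seq x n) (seq y n) (seq z n)
    ; zeroˡ = λ x → pointwise (0ℝ * x) 0ℝ λ n → ℚ.*-zeroˡ (seq x n)
    }
  }
  where
  isEquivalence : IsEquivalence _≃_
  isEquivalence = record
    { refl  = λ {x} → ≃-refl {x}
    ; sym   = λ {x} {y} → ≃-sym {x} {y}
    ; trans = λ {x} {y} {z} → ≃-trans {x} {y} {z}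
    }

-‿cong : ∀ {x y} → x ≃ y → - x ≃ - y
-‿cong {x} {y} x≃y ε 0<ε =
  eventually-map (λ n → ≡.subst (ℚ._< ε) (≡.sym (neg-close (seq x n) (seq y n)))) (x≃y ε 0<ε)

∣∣-cong : ∀ {x y} → x ≃ y → ∣ x ∣ ≃ ∣ y ∣
∣∣-cong {x} {y} x≃y ε 0<ε =
  eventually-map (λ n → ℚ.≤-<-trans (abs-close (seq x n) (seq y n))) (x≃y ε 0<ε)

private
  <-+ʳ : ∀ p {ε} → 0ℚ ℚ.< ε → p ℚ.< p ℚ.+ ε
  <-+ʳ p {ε} 0<ε = ≡.subst (ℚ._< p ℚ.+ ε) (ℚ.+-identityʳ p) (ℚ.+-monoʳ-< p 0<ε)

  +-halves : ∀ z ε → z ℚ.+ ½ ℚ.* ε ℚ.+ ½ ℚ.* ε ≡ z ℚ.+ ε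
  +-halves z ε = ≡.trans (ℚ.+-assoc z (½ ℚ.* ε) (½ ℚ.* ε)) (≡.cong (z ℚ.+_) (halves ε))

  half< : ∀ {ε} → 0ℚ ℚ.< ε → ½ ℚ.* ε ℚ.< ε
  half< {ε} 0<ε = ≡.subst (½ ℚ.* ε ℚ.<_) (halves ε) (<-+ʳ (½ ℚ.* ε) (half-pos 0<ε))

p≤∣p∣ : ∀ p → p ℚ.≤ ℚ.∣ p ∣
p≤∣p∣ p with ℚ.≤-total 0ℚ p
... | inj₁ 0≤p = ℚ.≤-reflexive (≡.sym (ℚ.0≤p⇒∣p∣≡p 0≤p))
... | inj₂ p≤0 = ℚ.≤-trans p≤0 (ℚ.0≤∣p∣ p)

pointwise-≤ : ∀ x y → (∀ n → seq x n ℚ.≤ seq y n) → x ≤ y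
pointwise-≤ x y x≤y ε 0<ε = 0 , λ n _ → ℚ.≤-<-trans (x≤y n) (<-+ʳ (seq y n) 0<ε)

≃⇒≤ : ∀ x y → x ≃ y → x ≤ y
≃⇒≤ x y x≃y ε 0<ε = eventually-map (λ n d<ε → begin-strict
    seq x n                                  ≡⟨ solve 2 (λ a b → a := b :+ (a :- b)) ≡.refl (seq x n) (seq y n) ⟩
    seq y n ℚ.+ (seq x n ℚ.- seq y n)        ≤⟨ ℚ.+-monoʳ-≤ (seq y n) (p≤∣p∣ (seq x n ℚ.- seq y n)) ⟩
    seq y n ℚ.+ dist (seq x n) (seq y n)     <⟨ ℚ.+-monoʳ-< (seq y n) d<ε ⟩
    seq y n ℚ.+ ε                            ∎) (x≃y ε 0<ε)
  where
  open ℚ.≤-Reasoning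
  open +-*-Solver

≤-trans : ∀ x y z → x ≤ y → y ≤ z → x ≤ z
≤-trans x y z x≤y y≤z ε 0<ε = eventually-× (λ n p q → begin-strict
    seq x n                               <⟨ p ⟩
    seq y n ℚ.+ ½ ℚ.* ε                   <⟨ ℚ.+-monoˡ-< (½ ℚ.* ε) q ⟩
    seq z n ℚ.+ ½ ℚ.* ε ℚ.+ ½ ℚ.* ε       ≡⟨ +-halves (seq z n) ε ⟩
    seq z n ℚ.+ ε                         ∎)
  (x≤y (½ ℚ.* ε) (half-pos 0<ε)) (y≤z (½ ℚ.* ε) (half-pos 0<ε))
  where open ℚ.≤-Reasoning

+-mono-≤ : ∀ x x' y y' → x ≤ x' → y ≤ y' → x + y ≤ x' + y'
+-mono-≤ x x' y y' x≤x' y≤y' ε 0<ε = eventually-× (λ n p q → begin-strict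
    seq x n ℚ.+ seq y n                                        <⟨ ℚ.+-mono-< p q ⟩
    (seq x' n ℚ.+ ½ ℚ.* ε) ℚ.+ (seq y' n ℚ.+ ½ ℚ.* ε)
      ≡⟨ solve 3 (λ a b e → (a :+ e) :+ (b :+ e) := (a :+ b) :+ (e :+ e)) ≡.refl (seq x' n) (seq y' n) (½ ℚ.* ε) ⟩
    (seq x' n ℚ.+ seq y' n) ℚ.+ (½ ℚ.* ε ℚ.+ ½ ℚ.* ε)          ≡⟨ ≡.cong (seq x' n ℚ.+ seq y' n ℚ.+_) (halves ε) ⟩
    seq x' n ℚ.+ seq y' n ℚ.+ ε                                ∎)
  (x≤x' (½ ℚ.* ε) (half-pos 0<ε)) (y≤y' (½ ℚ.* ε) (half-pos 0<ε))
  where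
  open ℚ.≤-Reasoning
  open +-*-Solver

∣+∣-≤ : ∀ x y u v → ∣ x ∣ ≤ u → ∣ y ∣ ≤ v → ∣ x + y ∣ ≤ u + v
∣+∣-≤ x y u v x≤u y≤v = ≤-trans (∣ x + y ∣) (∣ x ∣ + ∣ y ∣) (u + v)
  (pointwise-≤ (∣ x + y ∣) (∣ x ∣ + ∣ y ∣) λ n → ℚ.∣p+q∣≤∣p∣+∣q∣ (seq x n) (seq y n))
  (+-mono-≤ (∣ x ∣) u (∣ y ∣) v x≤u y≤v)

∣∣-≤-resp : ∀ x y z → x ≃ y → ∣ x ∣ ≤ z → ∣ y ∣ ≤ z
∣∣-≤-resp x y z x≃y = ≤-trans (∣ y ∣) (∣ x ∣) z
  (≃⇒≤ (∣ y ∣) (∣ x ∣) (∣∣-cong {y} {x} (≃-sym {x} {y} x≃y)))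

∣*∣-≤ : ∀ {B} x y z → 0ℚ ℚ.≤ B → Eventually (λ n → ℚ.∣ seq x n ∣ ℚ.≤ B) → ∣ y ∣ ≤ z → ∣ x * y ∣ ≤ fromℚ B * z
∣*∣-≤ {B} x y z 0≤B x≤B y≤z ε 0<ε =
  let (η , 0<η , Bη<½ε) = shrink 0≤B 0<ε
  in eventually-× (λ n p q → begin-strict
       ℚ.∣ seq x n ℚ.* seq y n ∣            ≡⟨ ℚ.∣p*q∣≡∣p∣*∣q∣ (seq x n) (seq y n) ⟩
       ℚ.∣ seq x n ∣ ℚ.* ℚ.∣ seq y n ∣      ≤⟨ ℚ.*-monoʳ-≤-nonNeg ℚ.∣ seq y n ∣ {{ℚ.nonNegative (ℚ.0≤∣p∣ (seq y n))}} p ⟩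
       B ℚ.* ℚ.∣ seq y n ∣                  ≤⟨ ℚ.*-monoˡ-≤-nonNeg B {{ℚ.nonNegative 0≤B}} (ℚ.<⇒≤ q) ⟩
       B ℚ.* (seq z n ℚ.+ η)                ≡⟨ ℚ.*-distribˡ-+ B (seq z n) η ⟩
       B ℚ.* seq z n ℚ.+ B ℚ.* η            <⟨ ℚ.+-monoʳ-< (B ℚ.* seq z n) (ℚ.<-trans Bη<½ε (half< 0<ε)) ⟩
       B ℚ.* seq z n ℚ.+ ε                  ∎) x≤B (y≤z η 0<η)
  where open ℚ.≤-Reasoning

scale-mono-≤ : ∀ {B C} x → B ℚ.≤ C → fromℚ B * ∣ x ∣ ≤ fromℚ C * ∣ x ∣
scale-mono-≤ {B} {C} x B≤C = pointwise-≤ (fromℚ B * ∣ x ∣) (fromℚ C * ∣ x ∣) λ n →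
  ℚ.*-monoʳ-≤-nonNeg ℚ.∣ seq x n ∣ {{ℚ.nonNegative (ℚ.0≤∣p∣ (seq x n))}} B≤C

scale-scale-≤ : ∀ B C {E} x z → z ≤ fromℚ B * (fromℚ C * ∣ x ∣) → B ℚ.* C ℚ.≤ E → z ≤ fromℚ E * ∣ x ∣
scale-scale-≤ B C {E} x z z≤ BC≤E = ≤-trans z (fromℚ B * (fromℚ C * ∣ x ∣)) (fromℚ E * ∣ x ∣) z≤
  (≤-trans (fromℚ B * (fromℚ C * ∣ x ∣)) (fromℚ (B ℚ.* C) * ∣ x ∣) (fromℚ E * ∣ x ∣)
    (≃⇒≤ (fromℚ B * (fromℚ C * ∣ x ∣)) (fromℚ (B ℚ.* C) * ∣ x ∣)
      (pointwise (fromℚ B * (fromℚ C * ∣ x ∣)) (fromℚ (B ℚ.* C) * ∣ x ∣) λ n → ≡.sym (ℚ.*-assoc B C ℚ.∣ seq x n ∣)))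
    (scale-mono-≤ x BC≤E))

<-fromℚ-mono : ∀ {δ δ'} x → δ ℚ.≤ δ' → x < fromℚ δ → x < fromℚ δ'
<-fromℚ-mono x δ≤δ' (ε , 0<ε , M , p) = ε , 0<ε , M , λ n M≤n → ℚ.<-≤-trans (p n M≤n) δ≤δ'

-- Half of η covers K · δ, the other half the slack that `_≤_` allows.
scale-< : ∀ {K δ η} x y → 0ℚ ℚ.≤ K → 0ℚ ℚ.< η → K ℚ.* δ ℚ.< ½ ℚ.* η →
          ∣ x ∣ ≤ fromℚ K * ∣ y ∣ → ∣ y ∣ < fromℚ δ → Eventually (λ n → ℚ.∣ seq x n ∣ ℚ.< η)
scale-< {K} {δ} {η} x y 0≤K 0<η Kδ<½η x≤Ky (ε , 0<ε , y<δ) = eventually-× (λ n p q → begin-strict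
    ℚ.∣ seq x n ∣                          <⟨ p ⟩
    K ℚ.* ℚ.∣ seq y n ∣ ℚ.+ ½ ℚ.* η        ≤⟨ ℚ.+-monoˡ-≤ (½ ℚ.* η) (ℚ.*-monoˡ-≤-nonNeg K {{ℚ.nonNegative 0≤K}}
                                               (ℚ.<⇒≤ (ℚ.<-trans (<-+ʳ ℚ.∣ seq y n ∣ 0<ε) q))) ⟩
    K ℚ.* δ ℚ.+ ½ ℚ.* η                    <⟨ ℚ.+-monoˡ-< (½ ℚ.* η) Kδ<½η ⟩
    ½ ℚ.* η ℚ.+ ½ ℚ.* η                    ≡⟨ halves η ⟩
    η                                      ∎) (x≤Ky (½ ℚ.* η) (half-pos 0<η)) y<δ
  where open ℚ.≤-Reasoning

eventually-half⇒< : ∀ {η} x → 0ℚ ℚ.< η → Eventually (λ n → ℚ.∣ seq x n ∣ ℚ.< ½ ℚ.* η) → ∣ x ∣ < fromℚ η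
eventually-half⇒< {η} x 0<η (M , p) = ½ ℚ.* η , half-pos 0<η , M , λ n M≤n →
  ≡.subst (ℚ.∣ seq x n ∣ ℚ.+ ½ ℚ.* η ℚ.<_) (halves η) (ℚ.+-monoˡ-< (½ ℚ.* η) (p n M≤n))

0<⊓ : ∀ {p q} → 0ℚ ℚ.< p → 0ℚ ℚ.< q → 0ℚ ℚ.< p ℚ.⊓ q
0<⊓ {p} {q} 0<p 0<q with ℚ.⊓-sel p q
... | inj₁ eq = ≡.subst (0ℚ ℚ.<_) (≡.sym eq) 0<p
... | inj₂ eq = ≡.subst (0ℚ ℚ.<_) (≡.sym eq) 0<q

-- Differentiation

-- e(y) = o(y − x), respectively e(y) = O(y − x), as y → x.
LittleO BigO : (x : ℝ) {Y : ℝ → Set} → (∀ y → Y y → ℝ) → Set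
LittleO x {Y} e = ∀ ε → 0ℚ ℚ.< ε → ∃ λ δ → 0ℚ ℚ.< δ ×
  (∀ y (q : Y y) → ∣ y - x ∣ < fromℚ δ → ∣ e y q ∣ ≤ fromℚ ε * ∣ y - x ∣)
BigO x {Y} e = ∃ λ K → 0ℚ ℚ.≤ K × ∃ λ δ → 0ℚ ℚ.< δ ×
  (∀ y (q : Y y) → ∣ y - x ∣ < fromℚ δ → ∣ e y q ∣ ≤ fromℚ K * ∣ y - x ∣)

<-⊓ˡ : ∀ δ δ' x → x < fromℚ (δ ℚ.⊓ δ') → x < fromℚ δ
<-⊓ˡ δ δ' x = <-fromℚ-mono x (ℚ.p⊓q≤p δ δ')

<-⊓ʳ : ∀ δ δ' x → x < fromℚ (δ ℚ.⊓ δ') → x < fromℚ δ'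
<-⊓ʳ δ δ' x = <-fromℚ-mono x (ℚ.p⊓q≤q δ δ')

-- `HasDerivativeAt` unfolds to `LittleO` of the linear error, so each differentiation rule below
-- reduces to an identity between errors, transported here together with a map of domains.
littleO-resp : ∀ x {Y Z : ℝ → Set} (e : ∀ y → Y y → ℝ) (e' : ∀ y → Z y → ℝ) (φ : ∀ y → Z y → Y y) →
               (∀ y q → e y (φ y q) ≃ e' y q) → LittleO x e → LittleO x e'
littleO-resp x e e' φ e≃e' o ε 0<ε =
  let (δ , 0<δ , bound) = o ε 0<ε
  in δ , 0<δ , λ y q y∈ → ∣∣-≤-resp (e y (φ y q)) (e' y q) (fromℚ ε * ∣ y - x ∣) (e≃e' y q) (bound y (φ y q) y∈)

littleO-+ : ∀ x {Y : ℝ → Set} (e e' : ∀ y → Y y → ℝ) → LittleO x e → LittleO x e' →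
            LittleO x (λ y q → e y q + e' y q)
littleO-+ x e e' o o' ε 0<ε =
  let (δ  , 0<δ  , bound)  = o  (½ ℚ.* ε) (half-pos 0<ε)
      (δ' , 0<δ' , bound') = o' (½ ℚ.* ε) (half-pos 0<ε)
      half = fromℚ (½ ℚ.* ε)
  in δ ℚ.⊓ δ' , 0<⊓ 0<δ 0<δ' , λ y q y∈ →
    ≤-trans (∣ e y q + e' y q ∣) (half * ∣ y - x ∣ + half * ∣ y - x ∣) (fromℚ ε * ∣ y - x ∣)
      (∣+∣-≤ (e y q) (e' y q) (half * ∣ y - x ∣) (half * ∣ y - x ∣)
        (bound y q (<-⊓ˡ δ δ' (∣ y - x ∣) y∈)) (bound' y q (<-⊓ʳ δ δ' (∣ y - x ∣) y∈)))
      (≃⇒≤ (half * ∣ y - x ∣ + half * ∣ y - x ∣) (fromℚ ε * ∣ y - x ∣)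
        (pointwise (half * ∣ y - x ∣ + half * ∣ y - x ∣) (fromℚ ε * ∣ y - x ∣) λ n →
          ≡.trans (≡.sym (ℚ.*-distribʳ-+ (seq (∣ y - x ∣) n) (½ ℚ.* ε) (½ ℚ.* ε)))
                  (≡.cong (ℚ._* seq (∣ y - x ∣) n) (halves ε))))

littleO-*ˡ : ∀ x {Y : ℝ → Set} c (e : ∀ y → Y y → ℝ) → LittleO x e → LittleO x (λ y q → c * e y q)
littleO-*ˡ x c e o ε 0<ε =
  let (B , 0≤B , c≤B)    = bounded c
      (η , 0<η , Bη<½ε)  = shrink 0≤B 0<ε
      (δ , 0<δ , bound)  = o η 0<η
  in δ , 0<δ , λ y q y∈ → scale-scale-≤ B η (y - x) (∣ c * e y q ∣)
       (∣*∣-≤ c (e y q) (fromℚ η * ∣ y - x ∣) 0≤B c≤B (bound y q y∈))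
       (ℚ.<⇒≤ (ℚ.<-trans Bη<½ε (half< 0<ε)))

-- One factor is made smaller than η, the other keeps its linear bound K', and η is chosen with K' ·
-- η below ε.
bigO-* : ∀ x {Y : ℝ → Set} (e e' : ∀ y → Y y → ℝ) → BigO x e → BigO x e' →
         LittleO x (λ y q → e y q * e' y q)
bigO-* x e e' (K , 0≤K , ρ , 0<ρ , bound) (K' , 0≤K' , ρ' , 0<ρ' , bound') ε 0<ε =
  let (η , 0<η , K'η<½ε) = shrink 0≤K' 0<ε
      (δ , 0<δ , Kδ<½η)  = shrink 0≤K 0<η
  in δ ℚ.⊓ (ρ ℚ.⊓ ρ') , 0<⊓ 0<δ (0<⊓ 0<ρ 0<ρ') , λ y q y∈ →
    let y∈ρρ' = <-⊓ʳ δ (ρ ℚ.⊓ ρ') (∣ y - x ∣) y∈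
    in scale-scale-≤ η K' (y - x) (∣ e y q * e' y q ∣)
         (∣*∣-≤ (e y q) (e' y q) (fromℚ K' * ∣ y - x ∣) (ℚ.<⇒≤ 0<η)
           (eventually-map (λ n → ℚ.<⇒≤)
             (scale-< (e y q) (y - x) 0≤K 0<η Kδ<½η (bound y q (<-⊓ˡ ρ ρ' (∣ y - x ∣) y∈ρρ'))
               (<-⊓ˡ δ (ρ ℚ.⊓ ρ') (∣ y - x ∣) y∈)))
           (bound' y q (<-⊓ʳ ρ ρ' (∣ y - x ∣) y∈ρρ')))
         (ℚ.<⇒≤ (≡.subst (ℚ._< ε) (ℚ.*-comm K' η) (ℚ.<-trans K'η<½ε (half< 0<ε))))

-- For ε = 1 the linear error is at most |y - x|, and the linear part is at most B · |y - x|; hence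
-- the constant 1 + B.
derivative⇒bigO : ∀ f x p d → HasDerivativeAt f x p d → BigO x (λ y q → app f y q - app f x p)
derivative⇒bigO f x p d f' =
  let (B , 0≤B , d≤B)   = bounded d
      (δ , 0<δ , bound) = f' 1ℚ (ℚ.positive⁻¹ 1ℚ)
  in 1ℚ ℚ.+ B , ℚ.+-mono-≤ (ℚ.<⇒≤ (ℚ.positive⁻¹ 1ℚ)) 0≤B , δ , 0<δ , λ y q y∈ →
    let h = ∣ y - x ∣
        error = (app f y q - app f x p) - d * (y - x)
        linear = d * (y - x)
        Δ = app f y q - app f x p
    in ≤-trans (∣ Δ ∣) (1ℝ * h + fromℚ B * h) (fromℚ (1ℚ ℚ.+ B) * h)
         (∣∣-≤-resp (error + linear) Δ (1ℝ * h + fromℚ B * h)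
           (pointwise (error + linear) Δ λ n →
             solve 2 (λ a b → (a :- b) :+ b := a) ≡.refl (seq Δ n) (seq linear n))
           (∣+∣-≤ error linear (1ℝ * h) (fromℚ B * h) (bound y q y∈)
             (∣*∣-≤ d (y - x) h 0≤B d≤B (pointwise-≤ h h λ n → ℚ.≤-refl))))
         (≃⇒≤ (1ℝ * h + fromℚ B * h) (fromℚ (1ℚ ℚ.+ B) * h)
           (pointwise (1ℝ * h + fromℚ B * h) (fromℚ (1ℚ ℚ.+ B) * h) λ n →
             ≡.sym (ℚ.*-distribʳ-+ (seq h n) 1ℚ B)))
  where open +-*-Solver

infixl 6 _⊞_
infixl 7 _⊠_

_⊞_ _⊠_ : ℝ⇀ℝ → ℝ⇀ℝ → ℝ⇀ℝ
f ⊞ g = record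
  { Dom      = λ x → Dom f x × Dom g x
  ; app      = λ x (p , q) → app f x p + app g x q
  ; app-cong = λ {x} {y} (p , q) (p' , q') x≃y →
      +-cong {app f x p} {app f y p'} {app g x q} {app g y q'} (app-cong f p p' x≃y) (app-cong g q q' x≃y)
  }
f ⊠ g = record
  { Dom      = λ x → Dom f x × Dom g x
  ; app      = λ x (p , q) → app f x p * app g x q
  ; app-cong = λ {x} {y} (p , q) (p' , q') x≃y →
      *-cong {app f x p} {app f y p'} {app g x q} {app g y q'} (app-cong f p p' x≃y) (app-cong g q q' x≃y)
  }

total : (g : ℝ → ℝ) → (∀ {s t} → s ≃ t → g s ≃ g t) → ℝ⇀ℝ
total g g-cong = record
  { Dom      = λ _ → ⊤
  ; app      = λ x _ → g x
  ; app-cong = λ {x} {y} _ _ → g-cong {x} {y}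
  }

-- For g = `curve u n` this is definitionally `alongCurve`.
precompose : ℝ⇀ℝ → (g : ℝ → ℝ) → (∀ {s t} → s ≃ t → g s ≃ g t) → ℝ⇀ℝ
precompose f g g-cong = record
  { Dom      = λ t → Dom f (g t)
  ; app      = λ t p → app f (g t) p
  ; app-cong = λ {s} {t} p q s≃t → app-cong f p q (g-cong {s} {t} s≃t)
  }

sum-rule : ∀ f g x p q d d' → HasDerivativeAt f x p d → HasDerivativeAt g x q d' →
           HasDerivativeAt (f ⊞ g) x (p , q) (d + d')
sum-rule f g x p q d d' f' g' =
  littleO-resp x {Z = Dom (f ⊞ g)} sum-error
    (λ { y r → (app (f ⊞ g) y r - app (f ⊞ g) x (p , q)) - (d + d') * (y - x) }) (λ _ r → r)
    (λ { y (p' , q') → pointwise (sum-error y (p' , q'))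
      ((app (f ⊞ g) y (p' , q') - app (f ⊞ g) x (p , q)) - (d + d') * (y - x)) λ n →
      solve 8 (λ f F g G d d' y x →
        ((f :- F) :- d :* (y :- x)) :+ ((g :- G) :- d' :* (y :- x)) :=
        ((f :+ g) :- (F :+ G)) :- (d :+ d') :* (y :- x)) ≡.refl
        (seq (app f y p') n) (seq (app f x p) n) (seq (app g y q') n) (seq (app g x q) n)
        (seq d n) (seq d' n) (seq y n) (seq x n) })
    (littleO-+ x f-error g-error
      (littleO-resp x (λ y p' → (app f y p' - app f x p) - d * (y - x)) f-error (λ _ → proj₁)
        (λ y r → ≃-refl {f-error y r}) f')
      (littleO-resp x (λ y q' → (app g y q' - app g x q) - d' * (y - x)) g-error (λ _ → proj₂)
        (λ y r → ≃-refl {g-error y r}) g'))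
  where
  open +-*-Solver
  f-error g-error sum-error : ∀ y → Dom (f ⊞ g) y → ℝ
  f-error y (p' , q') = (app f y p' - app f x p) - d * (y - x)
  g-error y (p' , q') = (app g y q' - app g x q) - d' * (y - x)
  sum-error y r = f-error y r + g-error y r

-- The error splits as G times the error of f, plus F times the error of g, plus Δf · Δg; the last
-- product is O · O and hence o.
product-rule : ∀ f g x p q d d' → HasDerivativeAt f x p d → HasDerivativeAt g x q d' →
               HasDerivativeAt (f ⊠ g) x (p , q) (d * app g x q + app f x p * d')
product-rule f g x p q d d' f' g' =
  littleO-resp x {Z = Dom (f ⊠ g)} total-error
    (λ { y r → (app (f ⊠ g) y r - F * G) - (d * G + F * d') * (y - x) }) (λ _ r → r)
    (λ { y (p' , q') → pointwise (total-error y (p' , q'))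
      ((app (f ⊠ g) y (p' , q') - F * G) - (d * G + F * d') * (y - x)) λ n →
      solve 8 (λ f F g G d d' y x →
        (G :* ((f :- F) :- d :* (y :- x)) :+ F :* ((g :- G) :- d' :* (y :- x))) :+ (f :- F) :* (g :- G) :=
        ((f :* g) :- (F :* G)) :- (d :* G :+ F :* d') :* (y :- x)) ≡.refl
        (seq (app f y p') n) (seq F n) (seq (app g y q') n) (seq G n)
        (seq d n) (seq d' n) (seq y n) (seq x n) })
    (littleO-+ x (λ y r → G * f-error y r + F * g-error y r) (λ y r → Δf y r * Δg y r)
      (littleO-+ x (λ y r → G * f-error y r) (λ y r → F * g-error y r)
        (littleO-*ˡ x G f-error
          (littleO-resp x (λ y p' → (app f y p' - F) - d * (y - x)) f-error (λ _ → proj₁)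
            (λ y r → ≃-refl {f-error y r}) f'))
        (littleO-*ˡ x F g-error
          (littleO-resp x (λ y q' → (app g y q' - G) - d' * (y - x)) g-error (λ _ → proj₂)
            (λ y r → ≃-refl {g-error y r}) g')))
      (bigO-* x Δf Δg (reindex {e = λ y p' → app f y p' - F} proj₁ (derivative⇒bigO f x p d f'))
        (reindex {e = λ y q' → app g y q' - G} proj₂ (derivative⇒bigO g x q d' g'))))
  where
  open +-*-Solver
  F G : ℝ
  F = app f x p
  G = app g x q
  f-error g-error Δf Δg total-error : ∀ y → Dom (f ⊠ g) y → ℝ
  f-error y (p' , q') = (app f y p' - F) - d * (y - x)
  g-error y (p' , q') = (app g y q' - G) - d' * (y - x)
  Δf y (p' , q') = app f y p' - F
  Δg y (p' , q') = app g y q' - G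
  total-error y r = (G * f-error y r + F * g-error y r) + Δf y r * Δg y r
  reindex : ∀ {Y : ℝ → Set} {e : ∀ y → Y y → ℝ} (φ : ∀ {y} → Dom (f ⊠ g) y → Y y) →
            BigO x e → BigO x (λ y r → e y (φ r))
  reindex φ (K , 0≤K , δ , 0<δ , bound) = K , 0≤K , δ , 0<δ , λ y r → bound y (φ r)

-- The error is that of f at g y plus d times that of g. The first is o(g y - g x), and g y - g x is
-- O(y - x). The order `d' * d` matches the value of `g' ⊠ precompose f' g`.
chain-rule : ∀ f g (g-cong : ∀ {s t} → s ≃ t → g s ≃ g t) x p d d' →
             HasDerivativeAt f (g x) p d → HasDerivativeAt (total g g-cong) x tt d' →
             HasDerivativeAt (precompose f g g-cong) x p (d' * d)
chain-rule f g g-cong x p d d' f' g' =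
  littleO-resp x total-error (λ y q → (app f (g y) q - F) - (d' * d) * (y - x)) (λ _ q → q)
    (λ y q → pointwise (total-error y q) ((app f (g y) q - F) - (d' * d) * (y - x)) λ n →
      solve 8 (λ f F g G d d' y x →
        ((f :- F) :- d :* (g :- G)) :+ d :* ((g :- G) :- d' :* (y :- x)) :=
        (f :- F) :- (d' :* d) :* (y :- x)) ≡.refl
        (seq (app f (g y) q) n) (seq F n) (seq (g y) n) (seq (g x) n)
        (seq d n) (seq d' n) (seq y n) (seq x n))
    (littleO-+ x f-error (λ y q → d * g-error y q) f-small
      (littleO-*ˡ x d g-error
        (littleO-resp x {Z = Dom f ∘ g} (λ y (_ : ⊤) → g-error' y) g-error (λ _ _ → tt)
          (λ y q → ≃-refl {g-error y q}) g')))
  where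
  open +-*-Solver
  F : ℝ
  F = app f (g x) p
  f-error g-error total-error : ∀ y → Dom f (g y) → ℝ
  g-error' : ℝ → ℝ
  f-error y q = (app f (g y) q - F) - d * (g y - g x)
  g-error' y = (g y - g x) - d' * (y - x)
  g-error y q = g-error' y
  total-error y q = f-error y q + d * g-error y q
  f-small : LittleO x f-error
  f-small ε 0<ε =
    let (K , 0≤K , ρ , 0<ρ , g-lip) = derivative⇒bigO (total g g-cong) x tt d' g'
        (η , 0<η , Kη<½ε)           = shrink 0≤K 0<ε
        (δ , 0<δ , f-bound)         = f' η 0<η
        -- Two halvings: one is consumed by the slack in `scale-<`, the other by the gap in
        -- `eventually-half⇒<`.
        (δ' , 0<δ' , Kδ'<½½δ)       = shrink 0≤K (half-pos 0<δ)
    in δ' ℚ.⊓ ρ , 0<⊓ 0<δ' 0<ρ , λ y q y∈ →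
      let g-bound = g-lip y tt (<-⊓ʳ δ' ρ (∣ y - x ∣) y∈)
      in scale-scale-≤ η K (y - x) (∣ f-error y q ∣)
           (≤-trans (∣ f-error y q ∣) (fromℚ η * ∣ g y - g x ∣) (fromℚ η * (fromℚ K * ∣ y - x ∣))
             (f-bound (g y) q (eventually-half⇒< (g y - g x) 0<δ
               (scale-< (g y - g x) (y - x) 0≤K (half-pos 0<δ) Kδ'<½½δ g-bound
                 (<-⊓ˡ δ' ρ (∣ y - x ∣) y∈))))
             (scale-≤ η (g y - g x) (fromℚ K * ∣ y - x ∣) (ℚ.<⇒≤ 0<η) g-bound))
           (ℚ.<⇒≤ (≡.subst (ℚ._< ε) (ℚ.*-comm K η) (ℚ.<-trans Kη<½ε (half< 0<ε))))
    where
    scale-≤ : ∀ c u z → 0ℚ ℚ.≤ c → ∣ u ∣ ≤ z → fromℚ c * ∣ u ∣ ≤ fromℚ c * z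
    scale-≤ c u z 0≤c u≤z = ≤-trans (fromℚ c * ∣ u ∣) (∣ fromℚ c * u ∣) (fromℚ c * z)
      (pointwise-≤ (fromℚ c * ∣ u ∣) (∣ fromℚ c * u ∣) λ n → ℚ.≤-reflexive
        (≡.trans (≡.cong (ℚ._* ℚ.∣ seq u n ∣) (≡.sym (ℚ.0≤p⇒∣p∣≡p 0≤c))) (≡.sym (ℚ.∣p*q∣≡∣p∣*∣q∣ c (seq u n)))))
      (∣*∣-≤ (fromℚ c) u z 0≤c (0 , λ _ _ → ℚ.≤-reflexive (ℚ.0≤p⇒∣p∣≡p 0≤c)) u≤z)

-- Neighbourhoods and uniqueness of derivatives

Near : ∀ {ℓ} → ℝ → (ℝ → Set ℓ) → Set ℓ
Near a P = ∃ λ r → 0ℚ ℚ.< r × (∀ x → ∣ x - a ∣ < fromℚ r → P x)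

near-map : ∀ {p q a} {P : ℝ → Set p} {Q : ℝ → Set q} → (∀ x → P x → Q x) → Near a P → Near a Q
near-map f (r , 0<r , p) = r , 0<r , λ x x∈ → f x (p x x∈)

near-× : ∀ {p q r a} {P : ℝ → Set p} {Q : ℝ → Set q} {R : ℝ → Set r} →
         (∀ x → P x → Q x → R x) → Near a P → Near a Q → Near a R
near-× {a = a} f (r , 0<r , p) (r' , 0<r' , q) = r ℚ.⊓ r' , 0<⊓ 0<r 0<r' , λ x x∈ →
  f x (p x (<-⊓ˡ r r' (∣ x - a ∣) x∈)) (q x (<-⊓ʳ r r' (∣ x - a ∣) x∈))

near-point : ∀ {p a} {P : ℝ → Set p} → Near a P → P a
near-point {a = a} (r , 0<r , p) = p a (eventually-half⇒< (a - a) 0<r (0 , λ n _ →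
  ≡.subst (ℚ._< ½ ℚ.* r) (≡.sym (dist-self (seq a n))) (half-pos 0<r)))

-- The gap witnessing |x - a| < r is itself an admissible radius around x, by the triangle
-- inequality.
near-interior : ∀ {p a} {P : ℝ → Set p} → Near a P → Near a (λ x → Near x P)
near-interior {a = a} (r , 0<r , p) = r , 0<r , λ { x (ε , 0<ε , x∈) → ε , 0<ε , λ { y (η , 0<η , y∈) →
  p y (η , 0<η , eventually-× (λ n p q → begin-strict
    dist (seq y n) (seq a n) ℚ.+ η
      ≡⟨ ≡.cong (λ z → ℚ.∣ z ∣ ℚ.+ η)
           (solve 3 (λ a x y → y :- a := (x :- a) :+ (y :- x)) ≡.refl (seq a n) (seq x n) (seq y n)) ⟩
    ℚ.∣ (seq x n ℚ.- seq a n) ℚ.+ (seq y n ℚ.- seq x n) ∣ ℚ.+ η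
      ≤⟨ ℚ.+-monoˡ-≤ η (ℚ.∣p+q∣≤∣p∣+∣q∣ (seq x n ℚ.- seq a n) (seq y n ℚ.- seq x n)) ⟩
    dist (seq x n) (seq a n) ℚ.+ dist (seq y n) (seq x n) ℚ.+ η
      ≡⟨ ℚ.+-assoc (dist (seq x n) (seq a n)) (dist (seq y n) (seq x n)) η ⟩
    dist (seq x n) (seq a n) ℚ.+ (dist (seq y n) (seq x n) ℚ.+ η)
      <⟨ ℚ.+-monoʳ-< (dist (seq x n) (seq a n)) q ⟩
    dist (seq x n) (seq a n) ℚ.+ ε
      <⟨ p ⟩
    r ∎) x∈ y∈) } }
  where
  open ℚ.≤-Reasoning
  open +-*-Solver

AgreeNear : ℝ → ℝ⇀ℝ → ℝ⇀ℝ → Set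
AgreeNear a f g = Near a λ x → Σ (Dom f x) λ p → Σ (Dom g x) λ q → app f x p ≃ app g x q

-- For each ε one test point y = x + η with rational η > 0 is enough: the difference of the two
-- linear errors is (d' - d) · η up to `≃`, and a positive rational cancels.
derivative-unique : ∀ f g x p q d d' → AgreeNear x f g →
                    HasDerivativeAt f x p d → HasDerivativeAt g x q d' → d ≃ d'
derivative-unique f g x p q d d' agree@(ρ , 0<ρ , f≃g) f' g' ε 0<ε =
  -- Two errors of ¼ε · η and a slack of ½ε · η in `_≤_` add up to ε · η.
  let ¼ε = ½ ℚ.* (½ ℚ.* ε)
      0<¼ε = half-pos (half-pos 0<ε)
      (δ  , 0<δ  , f-bound) = f' ¼ε 0<¼ε
      (δ' , 0<δ' , g-bound) = g' ¼ε 0<¼ε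
      δ″ = δ ℚ.⊓ (δ' ℚ.⊓ ρ)
      0<δ″ = 0<⊓ 0<δ (0<⊓ 0<δ' 0<ρ)
      -- A quarter of the common radius, so that |y - x| stays strictly below its half.
      η = ½ ℚ.* (½ ℚ.* δ″)
      0<η = half-pos (half-pos 0<δ″)
      y = x + fromℚ η
      h = y - x
      h≡η : ∀ n → seq h n ≡ η
      h≡η n = solve 2 (λ x e → (x :+ e) :- x := e) ≡.refl (seq x n) η
      ∣h∣≡η : ∀ n → seq (∣ h ∣) n ≡ η
      ∣h∣≡η n = ≡.trans (≡.cong ℚ.∣_∣ (h≡η n)) (ℚ.0≤p⇒∣p∣≡p (ℚ.<⇒≤ 0<η))
      y∈ : ∣ h ∣ < fromℚ δ″
      y∈ = eventually-half⇒< h 0<δ″ (0 , λ n _ → ≡.subst (ℚ._< ½ ℚ.* δ″) (≡.sym (∣h∣≡η n)) (half< (half-pos 0<δ″)))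
      y∈' = <-⊓ʳ δ (δ' ℚ.⊓ ρ) (∣ h ∣) y∈
      (py , qy , fy≃gy) = f≃g y (<-⊓ʳ δ' ρ (∣ h ∣) y∈')
      (px , qx , fx≃gx) = near-point {P = λ x → Σ (Dom f x) λ p → Σ (Dom g x) λ q → app f x p ≃ app g x q} agree
      Δf = app f y py - app f x p
      Δg = app g y qy - app g x q
      fx≃gx' = ≃-trans {app f x p} {app f x px} {app g x q} (app-cong f p px (≃-refl {x}))
        (≃-trans {app f x px} {app g x qx} {app g x q} fx≃gx (app-cong g qx q (≃-refl {x})))
      Δg≃Δf = ≃-sym {Δf} {Δg} (+-cong {app f y py} {app g y qy} {(- app f x p)} {(- app g x q)} fy≃gy
        (-‿cong {app f x p} {app g x q} fx≃gx'))
      E  = Δf - d * h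
      E' = Δg - d' * h
      E″ = Δf - d' * h
      bound = fromℚ ¼ε * ∣ h ∣
      E-bound = f-bound y py (<-⊓ˡ δ (δ' ℚ.⊓ ρ) (∣ h ∣) y∈)
      E″-bound = ∣∣-≤-resp E' E″ bound
        (+-cong {Δg} {Δf} {(- (d' * h))} {(- (d' * h))} Δg≃Δf (≃-refl { - (d' * h)}))
        (g-bound y qy (<-⊓ˡ δ' ρ (∣ h ∣) y∈'))
      -E″-bound = ≤-trans (∣ - E″ ∣) (∣ E″ ∣) bound
        (pointwise-≤ (∣ - E″ ∣) (∣ E″ ∣) λ n → ℚ.≤-reflexive (ℚ.∣-p∣≡∣p∣ (seq E″ n))) E″-bound
      difference : ∣ (d' - d) * h ∣ ≤ bound + bound
      difference = ∣∣-≤-resp (- E″ + E) ((d' - d) * h) (bound + bound)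
        (pointwise (- E″ + E) ((d' - d) * h) λ n →
          solve 4 (λ a d d' h → (:- (a :- d' :* h)) :+ (a :- d :* h) := (d' :- d) :* h) ≡.refl
            (seq Δf n) (seq d n) (seq d' n) (seq h n))
        (∣+∣-≤ (- E″) E bound bound -E″-bound E-bound)
      0<½εη = ℚ.positive⁻¹ (½ ℚ.* ε ℚ.* η)
        {{ℚ.pos*pos⇒pos (½ ℚ.* ε) {{ℚ.positive (half-pos 0<ε)}} η {{ℚ.positive 0<η}}}}
  in eventually-map {P = λ n → seq (∣ (d' - d) * h ∣) n ℚ.< seq (bound + bound) n ℚ.+ ½ ℚ.* ε ℚ.* η} (λ n lt → ℚ.*-cancelʳ-<-nonNeg η {{ℚ.nonNegative (ℚ.<⇒≤ 0<η)}} (begin-strict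
       dist (seq d n) (seq d' n) ℚ.* η              ≡⟨ ≡.cong (ℚ._* η) (dist-sym (seq d n) (seq d' n)) ⟩
       ℚ.∣ seq (d' - d) n ∣ ℚ.* η                   ≡⟨ ≡.cong (ℚ.∣ seq (d' - d) n ∣ ℚ.*_) (∣h∣≡η n) ⟨
       ℚ.∣ seq (d' - d) n ∣ ℚ.* ℚ.∣ seq h n ∣       ≡⟨ ℚ.∣p*q∣≡∣p∣*∣q∣ (seq (d' - d) n) (seq h n) ⟨
       ℚ.∣ seq ((d' - d) * h) n ∣                   <⟨ lt ⟩
       (¼ε ℚ.* seq (∣ h ∣) n ℚ.+ ¼ε ℚ.* seq (∣ h ∣) n) ℚ.+ ½ ℚ.* ε ℚ.* η
         ≡⟨ ≡.cong (λ z → (¼ε ℚ.* z ℚ.+ ¼ε ℚ.* z) ℚ.+ ½ ℚ.* ε ℚ.* η) (∣h∣≡η n) ⟩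
       (¼ε ℚ.* η ℚ.+ ¼ε ℚ.* η) ℚ.+ ½ ℚ.* ε ℚ.* η
         ≡⟨ collect ε η ⟩
       ε ℚ.* η ∎)) (difference (½ ℚ.* ε ℚ.* η) 0<½εη)
  where
  open ℚ.≤-Reasoning
  open +-*-Solver
  collect : ∀ ε η → (½ ℚ.* (½ ℚ.* ε) ℚ.* η ℚ.+ ½ ℚ.* (½ ℚ.* ε) ℚ.* η) ℚ.+ ½ ℚ.* ε ℚ.* η ≡ ε ℚ.* η
  collect = solve 2 (λ e h →
    (con ½ :* (con ½ :* e) :* h :+ con ½ :* (con ½ :* e) :* h) :+ con ½ :* e :* h := e :* h) ≡.refl

-- Uniqueness is applied at every x near a and requires agreement around x, which `near-interior`
-- provides.
agreeNear-derivative : ∀ a {f g f' g'} → AgreeNear a f g → IsDerivativeNear a f f' → IsDerivativeNear a g g' →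
                       AgreeNear a f' g'
agreeNear-derivative a {f} {g} {f'} {g'} f≃g df dg = near-× {a = a}
  (λ { x (near-x , (p , p' , d)) (q , q' , d') →
    p' , q' , derivative-unique f g x p q (app f' x p') (app g' x q') near-x d d' })
  (near-× {a = a} {P = λ x → AgreeNear x f g} (λ x → _,_)
    (near-interior {a = a} {P = λ x → Σ (Dom f x) λ p → Σ (Dom g x) λ q → app f x p ≃ app g x q} f≃g) df) dg

-- The two towers may choose different derivative functions, so the induction runs over pairs that
-- merely agree near a.
iteratedDerivative-unique : ∀ a {f g d d' n} → AgreeNear a f g →
  IteratedDerivative a d f n → IteratedDerivative a d' g n → d ≃ d'
iteratedDerivative-unique a {f} {g} {d} {d'} agree (zeroth p f≃d) (zeroth q g≃d') =
  let (p' , q' , fa≃ga) = near-point {P = λ x → Σ (Dom f x) λ p → Σ (Dom g x) λ q → app f x p ≃ app g x q} agree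
  in ≃-trans {d} {app f a p} {d'} (≃-sym {app f a p} {d} f≃d)
     (≃-trans {app f a p} {app f a p'} {d'} (app-cong f p p' (≃-refl {a}))
     (≃-trans {app f a p'} {app g a q'} {d'} fa≃ga
     (≃-trans {app g a q'} {app g a q} {d'} (app-cong g q' q (≃-refl {a})) g≃d')))
iteratedDerivative-unique a {f} {g} agree (next f' df ds) (next g' dg ds') =
  iteratedDerivative-unique a (agreeNear-derivative a {f} {g} {f'} {g'} agree df dg) ds ds'

agreeNear-refl : ∀ a f → Near a (Dom f) → AgreeNear a f f
agreeNear-refl a f = near-map {a = a} λ x p → p , p , app-cong f p p (≃-refl {x})

-- Factorials and their inverses in the reals

private
  fromℕ : ℕ → ℚ
  fromℕ n = (ℤ.+ n) ℚ./ 1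

  -- Reduction to lowest terms does not compute for a variable n, so the identity is checked on
  -- unnormalised fractions.
  fromℕ-suc : ∀ n → fromℕ (suc n) ≡ 1ℚ ℚ.+ fromℕ n
  fromℕ-suc n = ℚ.toℚᵘ-injective (begin
    ℚ.toℚᵘ (ℚ.fromℚᵘ (ℚᵘ.mkℚᵘ (ℤ.+ suc n) 0))   ≈⟨ ℚ.toℚᵘ-fromℚᵘ (ℚᵘ.mkℚᵘ (ℤ.+ suc n) 0) ⟩
    ℚᵘ.mkℚᵘ (ℤ.+ suc n) 0                       ≈⟨ ℚᵘ.*≡* (≡.cong (ℤ._* ℤ.+ 1) (≡.cong (λ z → (ℤ.+ 1) ℤ.+ z) (≡.sym (ℤ.*-identityʳ (ℤ.+ n))))) ⟩
    ℚᵘ.1ℚᵘ ℚᵘ.+ ℚᵘ.mkℚᵘ (ℤ.+ n) 0               ≈⟨ ℚᵘ.+-congʳ ℚᵘ.1ℚᵘ (ℚ.toℚᵘ-fromℚᵘ (ℚᵘ.mkℚᵘ (ℤ.+ n) 0)) ⟨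
    ℚᵘ.1ℚᵘ ℚᵘ.+ ℚ.toℚᵘ (fromℕ n)                ≈⟨ ℚ.toℚᵘ-homo-+ 1ℚ (fromℕ n) ⟨
    ℚ.toℚᵘ (1ℚ ℚ.+ fromℕ n)                     ∎)
    where open ℚᵘ.≃-Reasoning

  fromℕ-inverse : ∀ n .{{_ : ℕ.NonZero n}} → fromℕ n ℚ.* ((ℤ.+ 1) ℚ./ n) ≡ 1ℚ
  fromℕ-inverse (suc n) = ℚ.toℚᵘ-injective (begin
    ℚ.toℚᵘ (fromℕ (suc n) ℚ.* ((ℤ.+ 1) ℚ./ suc n))
      ≈⟨ ℚ.toℚᵘ-homo-* (fromℕ (suc n)) ((ℤ.+ 1) ℚ./ suc n) ⟩
    ℚ.toℚᵘ (fromℕ (suc n)) ℚᵘ.* ℚ.toℚᵘ ((ℤ.+ 1) ℚ./ suc n)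
      ≈⟨ ℚᵘ.*-cong (ℚ.toℚᵘ-fromℚᵘ (ℚᵘ.mkℚᵘ (ℤ.+ suc n) 0)) (ℚ.toℚᵘ-fromℚᵘ (ℚᵘ.mkℚᵘ (ℤ.+ 1) n)) ⟩
    ℚᵘ.mkℚᵘ (ℤ.+ suc n) 0 ℚᵘ.* ℚᵘ.mkℚᵘ (ℤ.+ 1) n
      ≈⟨ ℚᵘ.*≡* (≡.trans (ℤ.*-identityʳ _) (≡.trans (ℤ.*-identityʳ (ℤ.+ suc n))
           (≡.trans (≡.cong ℤ.+_ (≡.sym (ℕ.*-identityˡ (suc n)))) (≡.sym (ℤ.*-identityˡ _))))) ⟩
    ℚᵘ.1ℚᵘ ∎)
    where open ℚᵘ.≃-Reasoning

open CommutativeSemiring ℝ-commutativeSemiring using (semiring)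
open Algebra.Properties.Semiring.Mult semiring using () renaming (_×_ to _·_)
open Algebra.Definitions.RawSemiring (Algebra.Bundles.Semiring.rawSemiring semiring) using ()
  renaming (_^_ to _^′_; product to product′)
module ℝ-Mult = Algebra.Properties.Semiring.Mult semiring

·≃* : ∀ n x → n · x ≃ fromℚ (fromℕ n) * x
·≃* zero    x = pointwise 0ℝ (fromℚ (fromℕ 0) * x) λ n → ≡.sym (ℚ.*-zeroˡ (seq x n))
·≃* (suc n) x = ≃-trans {suc n · x} {x + fromℚ (fromℕ n) * x} {fromℚ (fromℕ (suc n)) * x}
  (+-cong {x} {x} {n · x} {fromℚ (fromℕ n) * x} (≃-refl {x}) (·≃* n x))
  (pointwise (x + fromℚ (fromℕ n) * x) (fromℚ (fromℕ (suc n)) * x) λ j → ≡.trans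
    (solve 2 (λ x m → x :+ m :* x := (con 1ℚ :+ m) :* x) ≡.refl (seq x j) (fromℕ n))
    (≡.cong (ℚ._* seq x j) (≡.sym (fromℕ-suc n))))
  where open +-*-Solver

!ℝ*1/! : ∀ n → n !ℝ * 1/ n ! ≃ 1ℝ
!ℝ*1/! n = pointwise (n !ℝ * 1/ n !) 1ℝ λ _ → fromℕ-inverse (n !)
  where instance _ = n ℕ.!≢0

!·1/! : ∀ n → (n !) · 1/ n ! ≃ 1ℝ
!·1/! n = ≃-trans {(n !) · 1/ n !} {n !ℝ * 1/ n !} {1ℝ} (·≃* (n !) (1/ n !)) (!ℝ*1/! n)

open FormalSeries ℝ-commutativeSemiring
open Exponential 1/_! !·1/!

-- Taylor series

-- v lists the Taylor coefficients at a, up to order n, of the n times differentiable function f.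
-- Coefficients of compound functions are constrained by ≃ instead of being computed in the index,
-- because deciding definitional equality of two reals unfolds their Cauchy moduli.
data Taylor (a : ℝ) : ℝ⇀ℝ → (ℕ → ℝ) → ℕ → Set₁ where
  zeroth : ∀ {f v} → Near a (Dom f) → (∀ p → app f a p ≃ v 0) → Taylor a f v 0
  next   : ∀ {f v v' n} f' → (∀ p → app f a p ≃ v 0) → IsDerivativeNear a f f' →
           (∀ j → v' j ≃ D v j) → Taylor a f' v' n → Taylor a f v (suc n)

taylor-value : ∀ {a f v n} → Taylor a f v n → ∀ p → app f a p ≃ v 0
taylor-value (zeroth _ val)     = val
taylor-value (next _ val _ _ _) = val

taylor-defined : ∀ {a f v n} → Taylor a f v n → Near a (Dom f)
taylor-defined {a} (zeroth dom _)    = dom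
taylor-defined {a} (next _ _ df _ _) = near-map {a = a} (λ _ → proj₁) df

taylor-truncate : ∀ {a f v k n} → k ℕ.≤ n → Taylor a f v n → Taylor a f v k
taylor-truncate z≤n       t                      = zeroth (taylor-defined t) (taylor-value t)
taylor-truncate (s≤s k≤n) (next f' val df v'≃ t) = next f' val df v'≃ (taylor-truncate k≤n t)

taylor-⊞ : ∀ {a f g v w x n} → (∀ j → x j ≃ v j + w j) →
           Taylor a f v n → Taylor a g w n → Taylor a (f ⊞ g) x n
taylor-⊞ {a} {f} {g} {v} {w} {x} x≃ (zeroth domf valf) (zeroth domg valg) =
  zeroth (near-× {a = a} (λ _ → _,_) domf domg) λ { (p , q) →
    ≃-trans {app f a p + app g a q} {v 0 + w 0} {x 0}
      (+-cong {app f a p} {v 0} {app g a q} {w 0} (valf p) (valg q)) (≃-sym {x 0} {v 0 + w 0} (x≃ 0)) }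
taylor-⊞ {a} {f} {g} {v} {w} {x} x≃ (next {v' = v'} f' valf df v'≃ tf) (next {v' = w'} g' valg dg w'≃ tg) =
  next {v' = D x} (f' ⊞ g') (λ { (p , q) →
      ≃-trans {app f a p + app g a q} {v 0 + w 0} {x 0}
        (+-cong {app f a p} {v 0} {app g a q} {w 0} (valf p) (valg q)) (≃-sym {x 0} {v 0 + w 0} (x≃ 0)) })
    (near-× {a = a} (λ { x (p , p' , d) (q , q' , d') →
      (p , q) , (p' , q') , sum-rule f g x p q (app f' x p') (app g' x q') d d' }) df dg)
    (λ j → ≃-refl {D x j})
    (taylor-⊞ {a} {f'} {g'} {v'} {w'} {D x} (D-+ {v} {v'} {w} {w'} {x} x≃ v'≃ w'≃) tf tg)

taylor-⊠ : ∀ {a f g v w x n} → (∀ j → x j ≃ (v ⊛ w) j) →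
           Taylor a f v n → Taylor a g w n → Taylor a (f ⊠ g) x n
taylor-⊠ {a} {f} {g} {v} {w} {x} x≃ (zeroth domf valf) (zeroth domg valg) =
  zeroth (near-× {a = a} (λ _ → _,_) domf domg) λ { (p , q) →
    ≃-trans {app f a p * app g a q} {v 0 * w 0} {x 0}
      (*-cong {app f a p} {v 0} {app g a q} {w 0} (valf p) (valg q)) (≃-sym {x 0} {v 0 * w 0} (x≃ 0)) }
taylor-⊠ {a} {f} {g} {v} {w} {x} {suc n} x≃
         tf₀@(next {v' = v'} f' valf df v'≃ tf) tg₀@(next {v' = w'} g' valg dg w'≃ tg) =
  next {v' = D x} (f' ⊠ g ⊞ f ⊠ g') (λ { (p , q) →
      ≃-trans {app f a p * app g a q} {v 0 * w 0} {x 0}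
        (*-cong {app f a p} {v 0} {app g a q} {w 0} (valf p) (valg q)) (≃-sym {x 0} {v 0 * w 0} (x≃ 0)) })
    (near-× {a = a} (λ { x (p , p' , d) (q , q' , d') →
      (p , q) , ((p' , q) , (p , q')) , product-rule f g x p q (app f' x p') (app g' x q') d d' }) df dg)
    (λ j → ≃-refl {D x j})
    (taylor-⊞ {a} {f' ⊠ g} {f ⊠ g'} {v' ⊛ w} {v ⊛ w'} {D x} (D-⊛ {v} {v'} {w} {w'} {x} x≃ v'≃ w'≃)
      -- The undifferentiated factor of each summand has one order to spare, which truncation
      -- discards.
      (taylor-⊠ {a} {f'} {g} {v'} {w} {v' ⊛ w} (λ j → ≃-refl {(v' ⊛ w) j}) tf (taylor-truncate (ℕ.n≤1+n n) tg₀))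
      (taylor-⊠ {a} {f} {g'} {v} {w'} {v ⊛ w'} (λ j → ≃-refl {(v ⊛ w') j}) (taylor-truncate (ℕ.n≤1+n n) tf₀) tg))

-- Differentiability at a gives a linear bound on g x - g a, and thereby continuity of g at a.
near-preimage : ∀ {ℓ} {P : ℝ → Set ℓ} a g (g-cong : ∀ {s t} → s ≃ t → g s ≃ g t) g' →
                IsDerivativeNear a (total g g-cong) g' → Near (g a) P → Near a (λ x → P (g x))
near-preimage a g g-cong g' dg (r , 0<r , P-near) =
  let (p , q , d)             = near-point {a = a} dg
      (K , 0≤K , ρ , 0<ρ , lip) = derivative⇒bigO (total g g-cong) a tt (app g' a q) d
      (δ , 0<δ , Kδ<½½r)      = shrink 0≤K (half-pos 0<r)
  in δ ℚ.⊓ ρ , 0<⊓ 0<δ 0<ρ , λ x x∈ → P-near (g x) (eventually-half⇒< (g x - g a) 0<r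
       (scale-< (g x - g a) (x - a) 0≤K (half-pos 0<r) Kδ<½½r
         (lip x tt (<-⊓ʳ δ ρ (∣ x - a ∣) x∈)) (<-⊓ˡ δ ρ (∣ x - a ∣) x∈)))

-- One more derivative of g than of f makes g continuous at a also when n = 0.
taylor-compose : ∀ {a f v w x n} g (g-cong : ∀ {s t} → s ≃ t → g s ≃ g t) → (∀ j → x j ≃ compose n v w j) →
  Taylor (g a) f v n → Taylor a (total g g-cong) w (suc n) → Taylor a (precompose f g g-cong) x n
taylor-compose {a} {f} {v} {w} {x} g g-cong x≃ (zeroth dom val) (next g' _ dg _ _) =
  zeroth (near-preimage {P = Dom f} a g g-cong g' dg dom) λ p →
    ≃-trans {app f (g a) p} {v 0} {x 0} (val p)
      (≃-sym {x 0} {v 0} (≃-trans {x 0} {compose 0 v w 0} {v 0} (x≃ 0) (compose-zero 0 v w)))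
taylor-compose {a} {f} {v} {w} {x} {suc n} g g-cong x≃
               (next {v' = v'} f' val df v'≃ tf) tg₀@(next {v' = w'} g' _ dg w'≃ tg) =
  next {v' = D x} (g' ⊠ precompose f' g g-cong)
    (λ p → ≃-trans {app f (g a) p} {v 0} {x 0} (val p)
      (≃-sym {x 0} {v 0} (≃-trans {x 0} {compose (suc n) v w 0} {v 0} (x≃ 0) (compose-zero (suc n) v w))))
    (near-× {a = a} (λ { x (p , p' , d) (_ , q' , d') →
        p , (q' , p') , chain-rule f g g-cong x p (app f' (g x) p') (app g' x q') d d' })
      (near-preimage {P = λ x → Σ (Dom f x) λ p → Σ (Dom f' x) λ q → HasDerivativeAt f x p (app f' x q)}
        a g g-cong g' dg df)
      dg)
    (λ j → ≃-refl {D x j})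
    (taylor-⊠ {a} {g'} {precompose f' g g-cong} {w'} {compose n v' w} {D x}
      (compose-D n {v} {v'} {w} {w'} {x} x≃ v'≃ w'≃)
      (taylor-truncate (ℕ.n≤1+n n) tg)
      (taylor-compose {a} {f'} {v'} {w} {compose n v' w} g g-cong (λ j → ≃-refl {compose n v' w j}) tf
        (taylor-truncate (ℕ.n≤1+n (suc n)) tg₀)))

-- The same tower of derivatives serves both functions. This passes from expressions in `⊞` and `⊠`,
-- whose domains are nested pairs, to the form `total` that `taylor-compose` expects.
taylor-transfer : ∀ {a f v n} g (g-cong : ∀ {s t} → s ≃ t → g s ≃ g t) (all : ∀ x → Dom f x) →
  (∀ x p → app f x p ≃ g x) → Taylor a f v n → Taylor a (total g g-cong) v n
taylor-transfer {a} {f} {v} g g-cong all f≃g (zeroth dom val) =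
  zeroth (near-map {a = a} (λ _ _ → tt) dom) λ _ →
    ≃-trans {g a} {app f a (all a)} {v 0} (≃-sym {app f a (all a)} {g a} (f≃g a (all a))) (val (all a))
taylor-transfer {a} {f} {v} g g-cong all f≃g (next f' val df v'≃ t) =
  next f' (λ _ → ≃-trans {g a} {app f a (all a)} {v 0} (≃-sym {app f a (all a)} {g a} (f≃g a (all a))) (val (all a)))
    (near-map {a = a} (λ { x (p , p' , d) → tt , p' ,
      littleO-resp x {Z = λ _ → ⊤} (λ y q → (app f y q - app f x p) - app f' x p' * (y - x))
        (λ y _ → (g y - g x) - app f' x p' * (y - x)) (λ y _ → all y)
        (λ y _ → let linear = - (app f' x p' * (y - x)) in
          +-cong {app f y (all y) - app f x p} {g y - g x} {linear} {linear}
            (+-cong {app f y (all y)} {g y} {(- app f x p)} {(- g x)} (f≃g y (all y))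
              (-‿cong {app f x p} {g x} (f≃g x p)))
            (≃-refl {linear})) d }) df) v'≃ t

-- Taylor series of polynomial curves

constᵣ : ℝ → ℝ⇀ℝ
constᵣ c = total (λ _ → c) (λ _ → ≃-refl {c})

idᵣ : ℝ⇀ℝ
idᵣ = total (λ x → x) (λ x≃y → x≃y)

constant-derivative : ∀ c x → HasDerivativeAt (constᵣ c) x tt 0ℝ
constant-derivative c x ε 0<ε = 1ℚ , ℚ.positive⁻¹ 1ℚ , λ y _ _ →
  let e = (c - c) - 0ℝ * (y - x) in
  pointwise-≤ (∣ e ∣) (fromℚ ε * ∣ y - x ∣) λ n → begin
    ℚ.∣ seq e n ∣                    ≡⟨ ≡.cong ℚ.∣_∣ (solve 2 (λ c h → (c :- c) :- con 0ℚ :* h := con 0ℚ) ≡.refl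
                                          (seq c n) (seq (y - x) n)) ⟩
    0ℚ                               ≡⟨ ℚ.*-zeroʳ ε ⟨
    ε ℚ.* 0ℚ                         ≤⟨ ℚ.*-monoˡ-≤-nonNeg ε {{ℚ.nonNegative (ℚ.<⇒≤ 0<ε)}} (ℚ.0≤∣p∣ (seq (y - x) n)) ⟩
    ε ℚ.* ℚ.∣ seq (y - x) n ∣        ∎
  where
  open ℚ.≤-Reasoning
  open +-*-Solver

-- The linear error is 0, as it is for the constant function 0, whose bound is reused.
identity-derivative : ∀ x → HasDerivativeAt idᵣ x tt 1ℝ
identity-derivative x =
  littleO-resp x {Z = λ _ → ⊤} (λ y _ → (0ℝ - 0ℝ) - 0ℝ * (y - x)) (λ y _ → (y - x) - 1ℝ * (y - x)) (λ _ _ → tt)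
    (λ y _ → pointwise ((0ℝ - 0ℝ) - 0ℝ * (y - x)) ((y - x) - 1ℝ * (y - x)) λ n →
      solve 1 (λ h → (con 0ℚ :- con 0ℚ) :- con 0ℚ :* h := h :- con 1ℚ :* h) ≡.refl (seq (y - x) n))
    (constant-derivative 0ℝ x)
  where open +-*-Solver

near-total : ∀ {ℓ a} {P : ℝ → Set ℓ} → (∀ x → P x) → Near a P
near-total all = 1ℚ , ℚ.positive⁻¹ 1ℚ , λ x _ → all x

taylor-constant : ∀ {a x} c n → (∀ j → x j ≃ constant c j) → Taylor a (constᵣ c) x n
taylor-constant {a} {x} c zero    x≃ = zeroth (near-total {a = a} λ _ → tt) λ _ → ≃-sym {x 0} {c} (x≃ 0)
taylor-constant {a} {x} c (suc n) x≃ = next {v' = D x} (constᵣ 0ℝ) (λ _ → ≃-sym {x 0} {c} (x≃ 0))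
  (near-total {a = a} λ x → tt , tt , constant-derivative c x) (λ j → ≃-refl {D x j})
  (taylor-constant {a} {D x} 0ℝ n (D-constant {x} c x≃))

taylor-identity : ∀ {x} n → (∀ j → x j ≃ variable-series j) → Taylor 0ℝ idᵣ x n
taylor-identity {x} zero    x≃ = zeroth (near-total {a = 0ℝ} λ _ → tt) λ _ → ≃-sym {x 0} {0ℝ} (x≃ 0)
taylor-identity {x} (suc n) x≃ = next {v' = D x} (constᵣ 1ℝ) (λ _ → ≃-sym {x 0} {0ℝ} (x≃ 0))
  (near-total {a = 0ℝ} λ x → tt , tt , identity-derivative x) (λ j → ≃-refl {D x j})
  (taylor-constant {0ℝ} {D x} 1ℝ n (D-variable {x} x≃))

sum-*ˡ : ∀ {n} t (f : Vector ℝ n) → sum (λ k → t * f k) ≃ t * sum f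
sum-*ˡ {zero}  t f = pointwise 0ℝ (t * 0ℝ) λ j → ≡.sym (ℚ.*-zeroʳ (seq t j))
sum-*ˡ {suc n} t f = ≃-trans {t * f zero + sum (λ k → t * f (suc k))} {t * f zero + t * sum (f ∘ suc)}
                             {t * (f zero + sum (f ∘ suc))}
  (+-cong {t * f zero} {t * f zero} {sum (λ k → t * f (suc k))} {t * sum (f ∘ suc)}
    (≃-refl {t * f zero}) (sum-*ˡ t (f ∘ suc)))
  (pointwise (t * f zero + t * sum (f ∘ suc)) (t * (f zero + sum (f ∘ suc))) λ j →
    ≡.sym (ℚ.*-distribˡ-+ (seq t j) (seq (f zero) j) (seq (sum (f ∘ suc)) j)))

sum-suc : ∀ {n} c t (f : Vector ℝ n) (h : Vector ℝ (suc n)) →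
          c ≃ h zero → (∀ k → t * f k ≃ h (suc k)) → c + t * sum f ≃ sum h
sum-suc c t f h c≃ f≃ = +-cong {c} {h zero} {t * sum f} {sum (λ k → h (suc k))} c≃
  (≃-trans {t * sum f} {sum (λ k → t * f k)} {sum (λ k → h (suc k))}
    (≃-sym {sum (λ k → t * f k)} {t * sum f} (sum-*ˡ t f))
    (sum-cong (λ k → t * f k) (λ k → h (suc k)) f≃))

curve-suc : ∀ u n t → u 0 + t * curve (u ∘ suc) n t ≃ curve u (suc n) t
curve-suc u n t = sum-suc {suc n} (u 0) t (λ k → (u ∘ suc) (toℕ k) * t ^ toℕ k) (λ k → u (toℕ k) * t ^ toℕ k)
  (pointwise (u 0) (u 0 * 1ℝ) λ j → ≡.sym (ℚ.*-identityʳ (seq (u 0) j)))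
  (λ k → pointwise (t * (u (suc (toℕ k)) * t ^ toℕ k)) (u (suc (toℕ k)) * (t * t ^ toℕ k)) λ j →
    solve 3 (λ u t p → t :* (u :* p) := u :* (t :* p)) ≡.refl
      (seq (u (suc (toℕ k))) j) (seq t j) (seq (t ^ toℕ k) j))
  where open +-*-Solver

curve-zero : ∀ u t → u 0 ≃ curve u 0 t
curve-zero u t = pointwise (u 0) (curve u 0 t) λ j → solve 1 (λ u → u := u :* con 1ℚ :+ con 0ℚ) ≡.refl (seq (u 0) j)
  where open +-*-Solver

curveᵣ : (ℕ → ℝ) → ℕ → ℝ⇀ℝ
curveᵣ u n = total (curve u n) λ {s} {t} → curve-cong u n {s} {t}

-- Induction on the degree by Horner's scheme, which uses only constants, the identity, one sum and
-- one product.
taylor-curve : ∀ {x} u m n → (∀ j → x j ≃ upToDegree m u j) → Taylor 0ℝ (curveᵣ u m) x n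
taylor-curve {x} u zero    n x≃ = taylor-transfer {0ℝ} {constᵣ (u 0)} {x}
  (curve u 0) (λ {s} {t} → curve-cong u 0 {s} {t}) (λ _ → tt) (λ t _ → curve-zero u t) (taylor-constant (u 0) n x≃)
taylor-curve {x} u (suc m) n x≃ = taylor-transfer {0ℝ} {constᵣ (u 0) ⊞ idᵣ ⊠ curveᵣ (u ∘ suc) m} {x}
  (curve u (suc m)) (λ {s} {t} → curve-cong u (suc m) {s} {t})
  (λ _ → tt , tt , tt) (λ t _ → curve-suc u m t)
  (taylor-⊞ {0ℝ} {constᵣ (u 0)} {idᵣ ⊠ curveᵣ (u ∘ suc) m} {constant (u 0)} {variable-series ⊛ y} {x}
    (λ j → ≃-trans {x j} {upToDegree (suc m) u j} {constant (u 0) j + (variable-series ⊛ y) j}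
      (x≃ j) (upToDegree-suc m u j))
    (taylor-constant {0ℝ} {constant (u 0)} (u 0) n λ j → ≃-refl {constant (u 0) j})
    (taylor-⊠ {0ℝ} {idᵣ} {curveᵣ (u ∘ suc) m} {variable-series} {y} {variable-series ⊛ y}
      (λ j → ≃-refl {(variable-series ⊛ y) j})
      (taylor-identity {variable-series} n λ j → ≃-refl {variable-series j})
      (taylor-curve {y} (u ∘ suc) m n λ j → ≃-refl {y j})))
  where
  y : ℕ → ℝ
  y = upToDegree m (u ∘ suc)

-- The radius is kept: half of the gap witnessing |x - b| < r absorbs the distance from a to b.
near-basepoint : ∀ {ℓ} {P : ℝ → Set ℓ} a b → a ≃ b → Near a P → Near b P
near-basepoint a b a≃b (r , 0<r , P-near) = r , 0<r , λ { x (ε , 0<ε , x∈) →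
  P-near x (½ ℚ.* ε , half-pos 0<ε , eventually-× (λ n b-close a-close → begin-strict
    dist (seq x n) (seq a n) ℚ.+ ½ ℚ.* ε
      ≡⟨ ≡.cong (λ z → ℚ.∣ z ∣ ℚ.+ ½ ℚ.* ε)
           (solve 3 (λ x a b → x :- a := (x :- b) :+ (b :- a)) ≡.refl (seq x n) (seq a n) (seq b n)) ⟩
    ℚ.∣ (seq x n ℚ.- seq b n) ℚ.+ (seq b n ℚ.- seq a n) ∣ ℚ.+ ½ ℚ.* ε
      ≤⟨ ℚ.+-monoˡ-≤ (½ ℚ.* ε) (ℚ.∣p+q∣≤∣p∣+∣q∣ (seq x n ℚ.- seq b n) (seq b n ℚ.- seq a n)) ⟩
    dist (seq x n) (seq b n) ℚ.+ dist (seq b n) (seq a n) ℚ.+ ½ ℚ.* ε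
      <⟨ ℚ.+-monoˡ-< (½ ℚ.* ε) (ℚ.+-monoʳ-< (dist (seq x n) (seq b n)) a-close) ⟩
    dist (seq x n) (seq b n) ℚ.+ ½ ℚ.* ε ℚ.+ ½ ℚ.* ε
      ≡⟨ +-halves (dist (seq x n) (seq b n)) ε ⟩
    dist (seq x n) (seq b n) ℚ.+ ε
      <⟨ b-close ⟩
    r ∎) x∈ (≃-sym {a} {b} a≃b (½ ℚ.* ε) (half-pos 0<ε))) }
  where
  open ℚ.≤-Reasoning
  open +-*-Solver

-- Needed because the curve at parameter 0 is `u 0` only up to `≃`.
taylor-basepoint : ∀ {f v n} a b → a ≃ b → Taylor a f v n → Taylor b f v n
taylor-basepoint {f} {v} a b a≃b (zeroth dom val) =
  zeroth (near-basepoint {P = Dom f} a b a≃b dom) λ q →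
    let p = near-point {a = a} {P = Dom f} dom
    in ≃-trans {app f b q} {app f a p} {v 0} (app-cong f q p (≃-sym {a} {b} a≃b)) (val p)
taylor-basepoint {f} {v} a b a≃b t₀@(next f' val df v'≃ t) =
  next f' (λ q →
    let p = near-point {a = a} {P = Dom f} (taylor-defined t₀)
    in ≃-trans {app f b q} {app f a p} {v 0} (app-cong f q p (≃-sym {a} {b} a≃b)) (val p))
    (near-basepoint {P = λ x → Σ (Dom f x) λ p → Σ (Dom f' x) λ q → HasDerivativeAt f x p (app f' x q)} a b a≃b df)
    v'≃ (taylor-basepoint a b a≃b t)

iteratedDerivative-resp : ∀ {a d d' f n} → d ≃ d' → IteratedDerivative a d f n → IteratedDerivative a d' f n
iteratedDerivative-resp {a} {d} {d'} {f} d≃d' (zeroth p val) = zeroth p (≃-trans {app f a p} {d} {d'} val d≃d')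
iteratedDerivative-resp {a} {d} {d'}     d≃d' (next f' df t) = next f' df (iteratedDerivative-resp {a} {d} {d'} d≃d' t)

taylor⇒iteratedDerivative : ∀ {a f v n} → Taylor a f v n → IteratedDerivative a ((n !) · v n) f n
taylor⇒iteratedDerivative {a} {f} {v} (zeroth dom val) =
  let p = near-point {a = a} {P = Dom f} dom
  in zeroth p (≃-trans {app f a p} {v 0} {1 · v 0} (val p) (≃-sym {1 · v 0} {v 0} (ℝ-Mult.×-homo-1 (v 0))))
taylor⇒iteratedDerivative {v = v} {n = suc n} (next {v' = v'} f' _ df v'≃ t) =
  next f' df (iteratedDerivative-resp {d = (n !) · v' n} {d' = (suc n !) · v (suc n)} (!·D {v} {v'} n v'≃)
    (taylor⇒iteratedDerivative t))

-- The coefficients of f' are integrated, with the value of f as constant term. At order 0 only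
-- coefficient 0 is constrained, so a constant sequence serves.
iteratedDerivative⇒taylor : ∀ {a d f n} → Near a (Dom f) → IteratedDerivative a d f n → ∃ λ v → Taylor a f v n
iteratedDerivative⇒taylor {a} {d} {f} dom (zeroth p val) = (λ _ → d) , zeroth dom λ q →
  ≃-trans {app f a q} {app f a p} {d} (app-cong f q p (≃-refl {a})) val
iteratedDerivative⇒taylor {a} {d} {f} dom (next f' df t) =
  let (v , t') = iteratedDerivative⇒taylor (near-map {a = a} (λ _ → proj₁ ∘ proj₂) df) t
      p = near-point {a = a} {P = Dom f} dom
  in antiderivative (app f a p) v , next f' (λ q → app-cong f q p (≃-refl {a})) df
       (D-antiderivative (app f a p) v) t'

-- The operations of ℝ-rawSemiring and those derived from ℝ-commutativeSemiring have the same
-- recursive definitions, but over records that agree only up to η.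
^-agrees : ∀ x k → x ^′ k ≃ x ^ k
^-agrees x zero    = ≃-refl {1ℝ}
^-agrees x (suc k) = *-cong {x} {x} {x ^′ k} {x ^ k} (≃-refl {x}) (^-agrees x k)

product-agrees : ∀ {m} (z : Vector ℝ m) → product′ z ≃ product z
product-agrees {zero}  z = ≃-refl {1ℝ}
product-agrees {suc m} z = *-cong {z zero} {z zero} {product′ (z ∘ suc)} {product (z ∘ suc)}
  (≃-refl {z zero}) (product-agrees (z ∘ suc))

listSum-agrees : ∀ {A : Set} (φ ψ : A → ℝ) → (∀ y → φ y ≃ ψ y) → ∀ xs →
                 listSum φ xs ≃ List.foldr _+_ 0ℝ (List.map ψ xs)
listSum-agrees φ ψ φ≃ψ []       = ≃-refl {0ℝ}
listSum-agrees φ ψ φ≃ψ (y ∷ xs) =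
  +-cong {φ y} {ψ y} {listSum φ xs} {List.foldr _+_ 0ℝ (List.map ψ xs)} (φ≃ψ y) (listSum-agrees φ ψ φ≃ψ xs)

dpow-agrees : ∀ x y a → x ≃ y → dpow x a ≃ 1/ a ! * y ^ a
dpow-agrees x y a x≃y = *-cong {1/ a !} {1/ a !} {x ^′ a} {y ^ a} (≃-refl {1/ a !})
  (≃-trans {x ^′ a} {x ^ a} {y ^ a} (^-agrees x a) (^-cong {x} {y} a x≃y))

monomial-agrees : ∀ {m} (y : Vector ℝ m) κ (z : Vector ℝ m) → (∀ i → dpow (y i) (lookup κ i) ≃ z i) →
                  monomial y κ ≃ product z
monomial-agrees y κ z z≃ = ≃-trans {monomial y κ} {product′ z} {product z} (monomial-≈ y κ z z≃) (product-agrees z)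

!·-agrees : ∀ n x y → x ≃ y → (n !) · x ≃ n !ℝ * y
!·-agrees n x y x≃y = ≃-trans {(n !) · x} {n !ℝ * x} {n !ℝ * y} (·≃* (n !) x)
  (*-cong {n !ℝ} {n !ℝ} {x} {y} (≃-refl {n !ℝ}) x≃y)

Bell-listSum : ∀ n k (x z : Vector ℝ (suc (n ℕ.∸ k))) → (∀ i → z i ≃ x i * 1/ suc (toℕ i) !) →
  (n !) · listSum (monomial z) (Λ n k) ≃ Bell n k x
Bell-listSum n k x z z≃ = !·-agrees n
  (listSum (monomial z) (Λ n k))
  (List.foldr _+_ 0ℝ
    (List.map (λ κ → product λ i → 1/ lookup κ i ! * (x i * 1/ suc (toℕ i) !) ^ lookup κ i) (Λ n k)))
  (listSum-agrees (monomial z)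
    (λ κ → product λ i → 1/ lookup κ i ! * (x i * 1/ suc (toℕ i) !) ^ lookup κ i)
    (λ κ → monomial-agrees z κ
      (λ i → 1/ lookup κ i ! * (x i * 1/ suc (toℕ i) !) ^ lookup κ i)
      (λ i → dpow-agrees (z i) (x i * 1/ suc (toℕ i) !) (lookup κ i) (z≃ i)))
    (Λ n k))

-- Adomian polynomials along the curve

curve-at-0 : ∀ u n → u 0 ≃ curve u n 0ℝ
curve-at-0 u n = ≃-sym {curve u n 0ℝ} {u 0} (≃-trans {curve u n 0ℝ} {upToDegree n u 0} {u 0}
  (taylor-value (taylor-curve {upToDegree n u} u n 0 λ j → ≃-refl {upToDegree n u j}) tt)
  (pointwise (upToDegree n u 0) (u 0) λ j → ≡.cong (λ z → seq z j) (upToDegree-≡ {n} u z≤n)))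

taylor-alongCurve : ∀ {N v w x} u n → (∀ j → w j ≃ upToDegree n u j) → (∀ j → x j ≃ compose n v w j) →
                    Taylor (u 0) N v n → Taylor 0ℝ (alongCurve N u n) x n
taylor-alongCurve {N} {v} {w} {x} u n w≃ x≃ t =
  taylor-compose {0ℝ} {N} {v} {w} {x} (curve u n) (λ {s} {t} → curve-cong u n {s} {t}) x≃
    (taylor-basepoint (u 0) (curve u n 0ℝ) (curve-at-0 u n) t) (taylor-curve {w} u n (suc n) w≃)

alongCurve-derivative : ∀ {N v w d} n u → (∀ j → w j ≃ upToDegree (suc n) u j) → Taylor (u 0) N v (suc n) →
  (suc n !) · compose (suc n) v w (suc n) ≃ d → IteratedDerivative 0ℝ d (alongCurve N u (suc n)) (suc n)
alongCurve-derivative {N} {v} {w} {d} n u w≃ t z≃d =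
  iteratedDerivative-resp {d = (suc n !) · compose (suc n) v w (suc n)} {d' = d} z≃d
    (taylor⇒iteratedDerivative {v = compose (suc n) v w}
      (taylor-alongCurve {N} {v} {w} {compose (suc n) v w} u (suc n) w≃ (λ j → ≃-refl {compose (suc n) v w j}) t))

near-defined : ∀ {a d f n} → IteratedDerivative a d f (suc n) → Near a (Dom f)
near-defined {a} (next _ df _) = near-map {a = a} (λ _ → proj₁) df

compose-derivatives : ∀ n (v u w : ℕ → ℝ) (N⁽_⁾[u₀] : ℕ → ℝ) →
  (∀ k → k ℕ.≤ suc n → (k !) · v k ≃ N⁽ k ⁾[u₀]) → (∀ {j} → j ℕ.≤ suc n → w j ≃ u j) →
  (x : ∀ k → Vector ℝ (suc (n ℕ.∸ k))) → (∀ k i → x k i ≃ u (suc (toℕ i))) →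
  (b : Vector ℝ (suc n)) → (∀ i → (suc n !) · listSum (monomial (x (toℕ i))) (Λ (suc n) (suc (toℕ i))) ≃ b i) →
  (y : Vector ℝ (suc n)) → (∀ i → y i ≃ b i * N⁽ suc (toℕ i) ⁾[u₀]) →
  (suc n !) · compose (suc n) v w (suc n) ≃ sum y
compose-derivatives n v u w N⁽_⁾[u₀] v≃ w≃u x x≃u b b≃ y y≃ = compose-Λ n v w x
  (λ k i → ≃-trans {x k i} {u (suc (toℕ i))} {w (suc (toℕ i))} (x≃u k i)
    (≃-sym {w (suc (toℕ i))} {u (suc (toℕ i))}
      -- Every argument of the Bell polynomials has index at most n+1, where truncating u changes
      -- nothing.
      (w≃u (s≤s (ℕ.≤-trans (ℕ.s≤s⁻¹ (Fin.toℕ<n i)) (ℕ.m∸n≤m n k))))))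
  y
  (λ i → ≃-trans {y i} {b i * N⁽ suc (toℕ i) ⁾[u₀]} {s i * ((suc (toℕ i) !) · v (suc (toℕ i)))} (y≃ i)
    (*-cong {b i} {s i} {N⁽ suc (toℕ i) ⁾[u₀]} {(suc (toℕ i) !) · v (suc (toℕ i))} (≃-sym {s i} {b i} (b≃ i))
      (≃-sym {(suc (toℕ i) !) · v (suc (toℕ i))} {N⁽ suc (toℕ i) ⁾[u₀]} (v≃ (suc (toℕ i)) (Fin.toℕ<n i)))))
  where
  s : Fin (suc n) → ℝ
  s i = (suc n !) · listSum (monomial (x (toℕ i))) (Λ (suc n) (suc (toℕ i)))

adomian-unique : ∀ N u n d → IteratedDerivative 0ℝ d (alongCurve N u (suc n)) (suc n) →
  IsAdomian N u (suc n) (1/ suc n ! * d) × (∀ A → IsAdomian N u (suc n) A → A ≃ 1/ suc n ! * d)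
adomian-unique N u n d derivative =
  (d , derivative , ≃-refl {1/ suc n ! * d}) ,
  λ { A (d' , derivative' , A≃) → ≃-trans {A} {1/ suc n ! * d'} {1/ suc n ! * d} A≃
    (*-cong {1/ suc n !} {1/ suc n !} {d'} {d} (≃-refl {1/ suc n !})
      (iteratedDerivative-unique 0ℝ
        (agreeNear-refl 0ℝ (alongCurve N u (suc n)) (near-defined derivative))
        derivative' derivative)) }

adomian-polynomial : ∀ n N (u : ℕ → ℝ) (N⁽_⁾[u₀] : ℕ → ℝ) → (∀ k → IteratedDerivative (u 0) (N⁽ k ⁾[u₀]) N k) →
  (x : ∀ k → Vector ℝ (suc (n ℕ.∸ k))) → (∀ k i → x k i ≃ u (suc (toℕ i))) →
  (b : Vector ℝ (suc n)) → (∀ i → (suc n !) · listSum (monomial (x (toℕ i))) (Λ (suc n) (suc (toℕ i))) ≃ b i) →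
  (y : Vector ℝ (suc n)) → (∀ i → y i ≃ b i * N⁽ suc (toℕ i) ⁾[u₀]) →
  IsAdomian N u (suc n) (1/ suc n ! * sum y) × (∀ A → IsAdomian N u (suc n) A → A ≃ 1/ suc n ! * sum y)
adomian-polynomial n N u N⁽_⁾[u₀] derivatives x x≃u b b≃ y y≃ =
  let defined  = near-defined (derivatives 1)
      (v , t)  = iteratedDerivative⇒taylor defined (derivatives (suc n))
      w        = upToDegree (suc n) u
  in adomian-unique N u n (sum y) (alongCurve-derivative {N} {v} {w} {sum y} n u (λ j → ≃-refl {w j}) t
       (compose-derivatives n v u w N⁽_⁾[u₀]
         -- Each given derivative of N comes with its own tower, whereas v is read from the single
         -- tower of order n+1; uniqueness identifies the values.
         (λ k k≤n → iteratedDerivative-unique (u 0) (agreeNear-refl (u 0) N defined)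
           (taylor⇒iteratedDerivative (taylor-truncate k≤n t)) (derivatives k))
         (λ {j} j≤n → pointwise (w j) (u j) λ i → ≡.cong (λ z → seq z i) (upToDegree-≡ u j≤n))
         x x≃u b b≃ y y≃))

-- The factor j! in the j-th argument cancels the division by j! inside `Bell`, leaving the plain
-- coefficient of the curve.
argument-unscaled : ∀ n x → x ≃ (n !ℝ * x) * 1/ n !
argument-unscaled n x = ≃-sym {(n !ℝ * x) * 1/ n !} {x} (≃-trans {(n !ℝ * x) * 1/ n !} {(n !ℝ * 1/ n !) * x} {x}
  (pointwise ((n !ℝ * x) * 1/ n !) ((n !ℝ * 1/ n !) * x) λ j →
    solve 3 (λ a b c → (a :* b) :* c := (a :* c) :* b) ≡.refl (seq (n !ℝ) j) (seq x j) (seq (1/ n !) j))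
  (≃-trans {(n !ℝ * 1/ n !) * x} {1ℝ * x} {x}
    (*-cong {n !ℝ * 1/ n !} {1ℝ} {x} {x} (!ℝ*1/! n) (≃-refl {x}))
    (pointwise (1ℝ * x) x λ j → ℚ.*-identityˡ (seq x j))))
  where open +-*-Solver

adomian-Bell : ∀ n N (u : ℕ → ℝ) (N⁽_⁾[u₀] : ℕ → ℝ) → (∀ k → IteratedDerivative (u 0) (N⁽ k ⁾[u₀]) N k) →
  (x : ∀ k → Vector ℝ (suc (n ℕ.∸ k))) → (∀ k i → x k i ≃ u (suc (toℕ i))) →
  (a : ∀ k → Vector ℝ (suc (suc n ℕ.∸ k))) → (∀ k i → x k i ≃ a (suc k) i * 1/ suc (toℕ i) !) →
  (y : Vector ℝ (suc n)) → (∀ i → y i ≃ Bell (suc n) (suc (toℕ i)) (a (suc (toℕ i))) * N⁽ suc (toℕ i) ⁾[u₀]) →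
  IsAdomian N u (suc n) (1/ suc n ! * sum y) × (∀ A → IsAdomian N u (suc n) A → A ≃ 1/ suc n ! * sum y)
adomian-Bell n N u N⁽_⁾[u₀] derivatives x x≃u a x≃a = adomian-polynomial n N u N⁽_⁾[u₀] derivatives x x≃u
  (λ i → Bell (suc n) (suc (toℕ i)) (a (suc (toℕ i))))
  (λ i → Bell-listSum (suc n) (suc (toℕ i)) (a (suc (toℕ i))) (x (toℕ i)) (x≃a (toℕ i)))

theorem2p3 : (n : ℕ) → 1 ℕ.≤ n →
    (N : ℝ⇀ℝ) (u : ℕ → ℝ) → AnalyticNear (u 0) N →
    (N⁽_⁾[u₀] : ℕ → ℝ) → (∀ k → IteratedDerivative (u 0) (N⁽ k ⁾[u₀]) N k) →
    let
      B : ℕ → ℝ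
      B k = Bell n k (λ i → suc (toℕ i) !ℝ * u (suc (toℕ i)))
      formula : ℝ
      formula = 1/ n ! * sum {n} (λ i → B (suc (toℕ i)) * N⁽ suc (toℕ i) ⁾[u₀])
    in
      IsAdomian N u n formula × (∀ A → IsAdomian N u n A → A ≃ formula)
theorem2p3 (suc n) _ N u _ N⁽_⁾[u₀] derivatives = adomian-Bell n N u N⁽_⁾[u₀] derivatives
  (λ k i → u (suc (toℕ i))) (λ k i → ≃-refl {u (suc (toℕ i))})
  (λ k i → suc (toℕ i) !ℝ * u (suc (toℕ i))) (λ k i → argument-unscaled (suc (toℕ i)) (u (suc (toℕ i))))
  (λ i → Bell (suc n) (suc (toℕ i)) (λ j → suc (toℕ j) !ℝ * u (suc (toℕ j))) * N⁽ suc (toℕ i) ⁾[u₀])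
  (λ i → ≃-refl {Bell (suc n) (suc (toℕ i)) (λ j → suc (toℕ j) !ℝ * u (suc (toℕ j))) * N⁽ suc (toℕ i) ⁾[u₀]})
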